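{- Let $k\in\mathbb{Z}$ and $\lambda,\mu\in\mathbb{C}$. For every integer $n\ge0$, as polynomials in $x$, $$CP_{n}^{(k)}(x;\lambda,\mu)=\sum_{m=0}^{n}(-1)^{m}\binom{n}{m}CP_{n-m}^{(k)}(0;\lambda,\mu)\,x^{(m)}.$$
   Context: All generating functions are formal power series in $t$ over $\mathbb{C}$. For $k\in\mathbb{Z}$, $\mathrm{Lif}_k(t)=\sum_{n=0}^{\infty}\frac{t^{n}}{n!(n+1)^{k}}$. For $\lambda,\mu\in\mathbb{C}$, $(1+t)^{\lambda}=\sum_{j\ge0}\binom{\lambda}{j}t^j$ and $(1+(1+t)^{\lambda})^{ -\mu}=2^{ -\mu}\bigl(1+\frac12\sum_{j\ge 1}\binom{\lambda}{j}t^{j}\bigr)^{ -\mu}$ (binomial series, $2^{ -\mu}=e^{ -\mu\log 2}$). The poly-Cauchy of the first kind and Peters mixed-type polynomials $CP_n^{(k)}(x;\lambda,\mu)$ are defined by $$(1+(1+t)^{\lambda})^{ -\mu}\,\mathrm{Lif}_k(\log(1+t))\,(1+t)^{ -x}=\sum_{n=0}^{\infty}CP_n^{(k)}(x;\lambda,\mu)\frac{t^n}{n!}.$$ The rising factorial is $x^{(m)}=x(x+1)\cdots(x+m-1)$, with $x^{(0)}=1$. -}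

module Defs where

open import Level using (0ℓ)
open import Data.Nat.Base as ℕ using (ℕ; zero; suc; _∸_; _!)
import Data.Nat.Properties as ℕ
open import Data.Integer.Base as ℤ using (ℤ; +_; -[1+_])
import Data.Integer.Properties as ℤ
import Data.Nat.Coprimality as Coprime
open import Data.Rational.Base as ℚ using (ℚ; mkℚ; 0ℚ; 1ℚ; ½; _/_; ∣_∣; *≤*; toℚᵘ)
import Data.Rational.Properties as ℚ
import Data.Rational.Unnormalised.Base as ℚᵘ
import Data.Rational.Unnormalised.Properties as ℚᵘ
open import Data.Fin.Base using (toℕ)
open import Data.List.Base using (List; []; _∷_; map)
open import Data.Product.Base using (∃-syntax; _,_; proj₁; proj₂) renaming (_×_ to infixr 2 _∧_)
open import Relation.Binary.PropositionalEquality
  using (_≡_; refl; sym; trans; cong; cong₂; subst; subst₂; isEquivalence)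
open import Algebra.Bundles using (RawRing; CommutativeRing)
open import Algebra.Solver.Ring.NaturalCoefficients.Default
  (CommutativeRing.commutativeSemiring ℚ.+-*-commutativeRing)
  using (solve; _:=_; _:+_; _:*_)
open import Algebra.Structures using (IsCommutativeRing)
import Algebra.Definitions.RawSemiring as RawSemiringDefs
import Algebra.Properties.Ring as RingProperties
import Algebra.Properties.Group as GroupProperties
import Algebra.Properties.CommutativeSemigroup as CommutativeSemigroupProperties

fromℕ : ℕ → ℚ
fromℕ n = mkℚ (+ n) 0 (Coprime.sym (Coprime.1-coprimeTo n))

recip : ℕ → ℚ
recip n = + 1 / suc n

opaque

  0≤fromℕ : ∀ n → 0ℚ ℚ.≤ fromℕ n
  0≤fromℕ n = ℚ.nonNegative⁻¹ (fromℕ n)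

  fromℕ-mono : ∀ {m n} → m ℕ.≤ n → fromℕ m ℚ.≤ fromℕ n
  fromℕ-mono {m} {n} m≤n = *≤* (ℤ.*-monoʳ-≤-nonNeg (+ 1) (ℤ.+≤+ m≤n))

  fromℕ-suc : ∀ n → fromℕ (suc n) ≡ 1ℚ ℚ.+ fromℕ n
  fromℕ-suc n = ℚ.toℚᵘ-injective (ℚᵘ.≃-trans
    (ℚᵘ.*≡* (cong (ℤ._* (+ 1)) (sym (cong (λ z → (+ 1) ℤ.+ z) (ℤ.*-identityʳ (+ n))))))
    (ℚᵘ.≃-sym (ℚ.toℚᵘ-homo-+ 1ℚ (fromℕ n))))

  recip-pos : ∀ n → ℚ.Positive (recip n)
  recip-pos n = ℚ.normalize-pos 1 (suc n)

  recip-inverse : ∀ n → recip n ℚ.* fromℕ (suc n) ≡ 1ℚ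
  recip-inverse n = ℚ.toℚᵘ-injective (ℚᵘ.≃-trans
    (ℚ.toℚᵘ-homo-* (recip n) (fromℕ (suc n)))
    (ℚᵘ.≃-trans
      (ℚᵘ.*-congʳ {toℚᵘ (fromℕ (suc n))} (ℚ.toℚᵘ-fromℚᵘ (ℚᵘ.mkℚᵘ (+ 1) n)))
      (ℚᵘ.*≡* (trans (ℤ.*-identityʳ _)
                (trans (ℤ.*-identityˡ _)
                  (sym (trans (ℤ.*-identityˡ _) (cong (λ m → + suc m) (ℕ.*-identityʳ n)))))))))

  0≤recip : ∀ n → 0ℚ ℚ.≤ recip n
  0≤recip n = ℚ.nonNegative⁻¹ (recip n) {{ℚ.pos⇒nonNeg (recip n) {{recip-pos n}}}}

  *-mono : ∀ {a b c d} → 0ℚ ℚ.≤ b → 0ℚ ℚ.≤ c → a ℚ.≤ b → c ℚ.≤ d → a ℚ.* c ℚ.≤ b ℚ.* d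
  *-mono {b = b} {c} 0≤b 0≤c a≤b c≤d = ℚ.≤-trans
    (ℚ.*-monoʳ-≤-nonNeg c {{ℚ.nonNegative 0≤c}} a≤b)
    (ℚ.*-monoˡ-≤-nonNeg b {{ℚ.nonNegative 0≤b}} c≤d)

  0≤* : ∀ {a b} → 0ℚ ℚ.≤ a → 0ℚ ℚ.≤ b → 0ℚ ℚ.≤ a ℚ.* b
  0≤* {a} {b} 0≤a 0≤b = subst (ℚ._≤ a ℚ.* b) (ℚ.*-zeroˡ 0ℚ)
    (*-mono 0≤a ℚ.≤-refl 0≤a 0≤b)

  0<* : ∀ {a b} → 0ℚ ℚ.< a → 0ℚ ℚ.< b → 0ℚ ℚ.< a ℚ.* b
  0<* {a} {b} 0<a 0<b = subst (ℚ._< a ℚ.* b) (ℚ.*-zeroʳ a)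
    (ℚ.*-monoʳ-<-pos a {{ℚ.positive 0<a}} 0<b)

  0<½* : ∀ {ε} → 0ℚ ℚ.< ε → 0ℚ ℚ.< ½ ℚ.* ε
  0<½* = 0<* (ℚ.positive⁻¹ ½)

  halves : ∀ ε → ½ ℚ.* ε ℚ.+ ½ ℚ.* ε ≡ ε
  halves ε = trans (sym (ℚ.*-distribʳ-+ ε ½ ½)) (ℚ.*-identityˡ ε)

  ceil : ∀ p → ∃[ n ] p ℚ.≤ fromℕ (suc n)
  ceil p@(mkℚ (+ n) d _) = n , *≤* (ℤ.≤-trans
    (ℤ.≤-reflexive (ℤ.*-identityʳ (+ n)))
    (ℤ.≤-trans (ℤ.+≤+ (ℕ.≤-trans (ℕ.n≤1+n n) (ℕ.m≤m*n (suc n) (suc d))))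
      (ℤ.≤-reflexive (ℤ.pos-* (suc n) (suc d)))))
  ceil p@(mkℚ -[1+ n ] d _) = 0 , ℚ.≤-trans
    (ℚ.<⇒≤ (ℚ.negative⁻¹ p)) (0≤fromℕ 1)

  archimedean : ∀ p {ε} → 0ℚ ℚ.< ε → ∃[ K ] ∀ k → K ℕ.≤ k → p ℚ.≤ fromℕ (suc k) ℚ.* ε
  archimedean p {ε} 0<ε = K , λ k K≤k → ℚ.≤-trans p≤ (ℚ.*-monoʳ-≤-nonNeg ε (fromℕ-mono (ℕ.s≤s K≤k)))
    where
    instance
      ε≢0 : ℚ.NonZero ε
      ε≢0 = ℚ.>-nonZero 0<ε
      ε≥0 : ℚ.NonNegative ε
      ε≥0 = ℚ.nonNegative (ℚ.<⇒≤ 0<ε)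
    q : ℚ
    q = p ℚ.* (ℚ.1/ ε)
    K : ℕ
    K = proj₁ (ceil q)
    p≤ : p ℚ.≤ fromℕ (suc K) ℚ.* ε
    p≤ = subst (ℚ._≤ fromℕ (suc K) ℚ.* ε)
      (trans (ℚ.*-assoc p (ℚ.1/ ε) ε) (trans (cong (p ℚ.*_) (ℚ.*-inverseˡ ε)) (ℚ.*-identityʳ p)))
      (ℚ.*-monoʳ-≤-nonNeg ε (proj₂ (ceil q)))

  -- From p ≤ b ε conclude p / b ≤ ε.
  ≤-recip : ∀ {p ε} k → p ℚ.≤ fromℕ (suc k) ℚ.* ε → recip k ℚ.* p ℚ.≤ ε
  ≤-recip {p} {ε} k p≤ = subst (recip k ℚ.* p ℚ.≤_)
    (trans (sym (ℚ.*-assoc (recip k) (fromℕ (suc k)) ε))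
      (trans (cong (ℚ._* ε) (recip-inverse k)) (ℚ.*-identityˡ ε)))
    (ℚ.*-monoˡ-≤-nonNeg (recip k) {{ℚ.nonNegative (0≤recip k)}} p≤)

  -- Every ε > 0 can be divided by any bound B.
  shrink : ∀ B {ε} → 0ℚ ℚ.< ε → ∃[ δ ] (0ℚ ℚ.< δ) ∧ (B ℚ.* δ ℚ.≤ ε)
  shrink B {ε} 0<ε = recip k ℚ.* ε , 0<* (ℚ.positive⁻¹ (recip k) {{recip-pos k}}) 0<ε
    , subst (ℚ._≤ ε) (swap (recip k) B ε) (≤-recip k (ℚ.*-monoʳ-≤-nonNeg ε {{ℚ.nonNegative (ℚ.<⇒≤ 0<ε)}} (proj₂ (ceil B))))
    where
    k : ℕ
    k = proj₁ (ceil B)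
    swap : ∀ r b e → r ℚ.* (b ℚ.* e) ≡ b ℚ.* (r ℚ.* e)
    swap = solve 3 (λ r b e → r :* (b :* e) := b :* (r :* e)) refl

partial : (ℕ → ℚ) → ℕ → ℚ
partial c zero    = 0ℚ
partial c (suc n) = partial c n ℚ.+ c n

-- Eventual comparison with a geometric series of ratio 1/2.
record Halving (c : ℕ → ℚ) : Set where
  field
    nonneg : ∀ n → 0ℚ ℚ.≤ c n
    start  : ℕ
    halve  : ∀ n → start ℕ.≤ n → c (suc n) ℚ.+ c (suc n) ℚ.≤ c n

module _ {c : ℕ → ℚ} (H : Halving c) where
  open Halving H
  opaque

    private
      arith₂ : ∀ s x → (s ℚ.+ x) ℚ.+ x ≡ s ℚ.+ (x ℚ.+ x)
      arith₂ = λ s x → ℚ.+-assoc s x x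
      arith₃ : ∀ i k x → (i ℚ.+ (i ℚ.+ k)) ℚ.* x ℚ.+ k ℚ.* x ≡ (i ℚ.+ k) ℚ.* (x ℚ.+ x)
      arith₃ = solve 3 (λ i k x → (i :+ (i :+ k)) :* x :+ k :* x := (i :+ k) :* (x :+ x)) refl

      p≤p+q : ∀ {p q} → 0ℚ ℚ.≤ q → p ℚ.≤ p ℚ.+ q
      p≤p+q {p} {q} 0≤q = subst (ℚ._≤ p ℚ.+ q) (ℚ.+-identityʳ p) (ℚ.+-monoʳ-≤ p 0≤q)

    tail′ : ∀ n → start ℕ.≤ n → ∀ k →
      partial c (k ℕ.+ n) ℚ.+ (c (k ℕ.+ n) ℚ.+ c (k ℕ.+ n)) ℚ.≤ partial c n ℚ.+ (c n ℚ.+ c n)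
    tail′ n s≤n zero    = ℚ.≤-refl
    tail′ n s≤n (suc k) = ℚ.≤-trans
      (ℚ.+-monoʳ-≤ (partial c (k ℕ.+ n) ℚ.+ c (k ℕ.+ n))
        (halve (k ℕ.+ n) (ℕ.≤-trans s≤n (ℕ.m≤n+m n k))))
      (ℚ.≤-trans (ℚ.≤-reflexive (arith₂ (partial c (k ℕ.+ n)) (c (k ℕ.+ n)))) (tail′ n s≤n k))

    tail : ∀ n → start ℕ.≤ n → ∀ k →
      partial c (k ℕ.+ n) ℚ.≤ partial c n ℚ.+ (c n ℚ.+ c n)
    tail n s≤n k = ℚ.≤-trans (p≤p+q (ℚ.+-mono-≤ (nonneg _) (nonneg _))) (tail′ n s≤n k)

    partial-mono : ∀ n k → partial c n ℚ.≤ partial c (k ℕ.+ n)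
    partial-mono n zero    = ℚ.≤-refl
    partial-mono n (suc k) = ℚ.≤-trans (partial-mono n k) (p≤p+q (nonneg _))

    bound : ℚ
    bound = partial c start ℚ.+ (c start ℚ.+ c start)

    partial≤bound : ∀ n → partial c n ℚ.≤ bound
    partial≤bound n = ℚ.≤-trans
      (subst (λ m → partial c n ℚ.≤ partial c m) (ℕ.+-comm start n) (partial-mono n start))
      (tail start ℕ.≤-refl n)

    decay : ∀ k → fromℕ (suc k) ℚ.* c (k ℕ.+ start) ℚ.≤ c start
    decay zero    = ℚ.≤-reflexive (ℚ.*-identityˡ (c start))
    decay (suc k) = ℚ.≤-trans
      (p≤p+q (0≤* (0≤fromℕ k) (nonneg (suc k ℕ.+ start))))
      (ℚ.≤-trans
        (ℚ.≤-reflexive (trans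
          (cong (λ z → z ℚ.* x ℚ.+ fromℕ k ℚ.* x)
            (trans (fromℕ-suc (suc k)) (cong (1ℚ ℚ.+_) (fromℕ-suc k))))
          (trans (arith₃ 1ℚ (fromℕ k) x) (cong (ℚ._* (x ℚ.+ x)) (sym (fromℕ-suc k))))))
        (ℚ.≤-trans
          (ℚ.*-monoˡ-≤-nonNeg (fromℕ (suc k)) (halve (k ℕ.+ start) (ℕ.m≤n+m start k)))
          (decay k)))
      where
      x : ℚ
      x = c (suc k ℕ.+ start)

    vanish : ∀ {ε} → 0ℚ ℚ.< ε → ∃[ N ] ∀ n → N ℕ.≤ n → start ℕ.≤ n ∧ c n ℚ.≤ ε
    vanish {ε} 0<ε = K ℕ.+ start , λ n K+s≤n →
        ℕ.≤-trans (ℕ.m≤n+m start K) K+s≤n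
      , subst (λ m → c m ℚ.≤ ε) (ℕ.m∸n+n≡m (ℕ.≤-trans (ℕ.m≤n+m start K) K+s≤n))
          (small (n ∸ start) (ℕ.m+n≤o⇒m≤o∸n K K+s≤n))
      where
      K : ℕ
      K = proj₁ (archimedean (c start) 0<ε)
      small : ∀ k → K ℕ.≤ k → c (k ℕ.+ start) ℚ.≤ ε
      small k K≤k = ℚ.*-cancelˡ-≤-pos (fromℕ (suc k))
        (ℚ.≤-trans (decay k) (proj₂ (archimedean (c start) 0<ε) k K≤k))

    tails-vanish : ∀ {ε} → 0ℚ ℚ.< ε → ∃[ N ] ∀ n k → N ℕ.≤ n →
      partial c (k ℕ.+ n) ℚ.≤ partial c n ℚ.+ ε
    tails-vanish {ε} 0<ε = proj₁ v , λ n k N≤n → ℚ.≤-trans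
      (tail n (proj₁ (proj₂ v n N≤n)) k)
      (ℚ.+-monoʳ-≤ (partial c n) (subst (c n ℚ.+ c n ℚ.≤_) (halves ε)
        (ℚ.+-mono-≤ (proj₂ (proj₂ v n N≤n)) (proj₂ (proj₂ v n N≤n)))))
      where
      v : ∃[ N ] ∀ n → N ℕ.≤ n → start ℕ.≤ n ∧ c n ℚ.≤ ½ ℚ.* ε
      v = vanish (0<½* 0<ε)

infix 4 _+i_
record ℚ[i] : Set where
  constructor _+i_
  field
    re im : ℚ

open ℚ[i]

infixl 6 _⊕_
infixl 7 _⊗_
infix  8 ⊖_
infixr 7 _•_

_⊕_ _⊗_ : ℚ[i] → ℚ[i] → ℚ[i]
(a +i b) ⊕ (c +i d) = a ℚ.+ c +i b ℚ.+ d
(a +i b) ⊗ (c +i d) = a ℚ.* c ℚ.- b ℚ.* d +i a ℚ.* d ℚ.+ b ℚ.* c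

⊖_ : ℚ[i] → ℚ[i]
⊖ (a +i b) = ℚ.- a +i ℚ.- b

embed : ℚ → ℚ[i]
embed q = q +i 0ℚ

_•_ : ℚ → ℚ[i] → ℚ[i]
q • (a +i b) = q ℚ.* a +i q ℚ.* b

module _ where
  private
    j : ℚ
    j = ℚ.- 1ℚ

    mul : ℚ[i] → ℚ[i] → ℚ[i]
    mul (a +i b) (c +i d) = a ℚ.* c ℚ.+ j ℚ.* (b ℚ.* d) +i a ℚ.* d ℚ.+ b ℚ.* c

  opaque
    private
      ⊗≡mul : ∀ z w → z ⊗ w ≡ mul z w
      ⊗≡mul (a +i b) (c +i d) = cong (λ t → a ℚ.* c ℚ.+ t +i a ℚ.* d ℚ.+ b ℚ.* c)
        (sym (-1*x≈-x (b ℚ.* d)))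
        where open RingProperties ℚ.+-*-ring using (-1*x≈-x)

      assocRe : ∀ k a b c d e f →
        (a ℚ.* c ℚ.+ k ℚ.* (b ℚ.* d)) ℚ.* e ℚ.+ k ℚ.* ((a ℚ.* d ℚ.+ b ℚ.* c) ℚ.* f) ≡
        a ℚ.* (c ℚ.* e ℚ.+ k ℚ.* (d ℚ.* f)) ℚ.+ k ℚ.* (b ℚ.* (c ℚ.* f ℚ.+ d ℚ.* e))
      assocRe = solve 7 (λ k a b c d e f →
        (a :* c :+ k :* (b :* d)) :* e :+ k :* ((a :* d :+ b :* c) :* f) :=
        a :* (c :* e :+ k :* (d :* f)) :+ k :* (b :* (c :* f :+ d :* e))) refl

      assocIm : ∀ k a b c d e f →
        (a ℚ.* c ℚ.+ k ℚ.* (b ℚ.* d)) ℚ.* f ℚ.+ (a ℚ.* d ℚ.+ b ℚ.* c) ℚ.* e ≡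
        a ℚ.* (c ℚ.* f ℚ.+ d ℚ.* e) ℚ.+ b ℚ.* (c ℚ.* e ℚ.+ k ℚ.* (d ℚ.* f))
      assocIm = solve 7 (λ k a b c d e f →
        (a :* c :+ k :* (b :* d)) :* f :+ (a :* d :+ b :* c) :* e :=
        a :* (c :* f :+ d :* e) :+ b :* (c :* e :+ k :* (d :* f))) refl

      distribRe : ∀ k a b c d e f →
        a ℚ.* (c ℚ.+ e) ℚ.+ k ℚ.* (b ℚ.* (d ℚ.+ f)) ≡
        (a ℚ.* c ℚ.+ k ℚ.* (b ℚ.* d)) ℚ.+ (a ℚ.* e ℚ.+ k ℚ.* (b ℚ.* f))
      distribRe = solve 7 (λ k a b c d e f →
        a :* (c :+ e) :+ k :* (b :* (d :+ f)) :=
        (a :* c :+ k :* (b :* d)) :+ (a :* e :+ k :* (b :* f))) refl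

      distribIm : ∀ a b c d e f →
        a ℚ.* (d ℚ.+ f) ℚ.+ b ℚ.* (c ℚ.+ e) ≡
        (a ℚ.* d ℚ.+ b ℚ.* c) ℚ.+ (a ℚ.* f ℚ.+ b ℚ.* e)
      distribIm = solve 6 (λ a b c d e f →
        a :* (d :+ f) :+ b :* (c :+ e) :=
        (a :* d :+ b :* c) :+ (a :* f :+ b :* e)) refl

    ⊗-assoc : ∀ x y z → (x ⊗ y) ⊗ z ≡ x ⊗ (y ⊗ z)
    ⊗-assoc x@(a +i b) y@(c +i d) z@(e +i f) = trans
      (trans (⊗≡mul (x ⊗ y) z) (cong (λ u → mul u z) (⊗≡mul x y)))
      (trans (cong₂ _+i_ (assocRe j a b c d e f) (assocIm j a b c d e f))
        (sym (trans (⊗≡mul x (y ⊗ z)) (cong (mul x) (⊗≡mul y z)))))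

    ⊗-comm : ∀ x y → x ⊗ y ≡ y ⊗ x
    ⊗-comm (a +i b) (c +i d) = cong₂ _+i_
      (cong₂ ℚ._-_ (ℚ.*-comm a c) (ℚ.*-comm b d))
      (trans (ℚ.+-comm (a ℚ.* d) (b ℚ.* c)) (cong₂ ℚ._+_ (ℚ.*-comm b c) (ℚ.*-comm a d)))

    ⊗-distribˡ : ∀ x y z → x ⊗ (y ⊕ z) ≡ (x ⊗ y) ⊕ (x ⊗ z)
    ⊗-distribˡ x@(a +i b) y@(c +i d) z@(e +i f) = trans (⊗≡mul x (y ⊕ z))
      (trans (cong₂ _+i_ (distribRe j a b c d e f) (distribIm a b c d e f))
        (sym (cong₂ _⊕_ (⊗≡mul x y) (⊗≡mul x z))))

    ⊗-identityˡ : ∀ x → embed 1ℚ ⊗ x ≡ x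
    ⊗-identityˡ (a +i b) = cong₂ _+i_
      (trans (cong₂ (λ u v → u ℚ.- v) (ℚ.*-identityˡ a) (ℚ.*-zeroˡ b)) (ℚ.+-identityʳ a))
      (trans (cong₂ ℚ._+_ (ℚ.*-identityˡ b) (ℚ.*-zeroˡ a)) (ℚ.+-identityʳ b))

    ℚ[i]-isCommutativeRing : IsCommutativeRing _≡_ _⊕_ _⊗_ ⊖_ (embed 0ℚ) (embed 1ℚ)
    ℚ[i]-isCommutativeRing = record
      { isRing = record
        { +-isAbelianGroup = record
          { isGroup = record
            { isMonoid = record
              { isSemigroup = record
                { isMagma = record { isEquivalence = isEquivalence ; ∙-cong = cong₂ _⊕_ }
                ; assoc = λ x y z → cong₂ _+i_ (ℚ.+-assoc (re x) (re y) (re z)) (ℚ.+-assoc (im x) (im y) (im z)) }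
              ; identity = (λ x → cong₂ _+i_ (ℚ.+-identityˡ (re x)) (ℚ.+-identityˡ (im x)))
                         , (λ x → cong₂ _+i_ (ℚ.+-identityʳ (re x)) (ℚ.+-identityʳ (im x))) }
            ; inverse = (λ x → cong₂ _+i_ (ℚ.+-inverseˡ (re x)) (ℚ.+-inverseˡ (im x)))
                      , (λ x → cong₂ _+i_ (ℚ.+-inverseʳ (re x)) (ℚ.+-inverseʳ (im x)))
            ; ⁻¹-cong = cong ⊖_ }
          ; comm = λ x y → cong₂ _+i_ (ℚ.+-comm (re x) (re y)) (ℚ.+-comm (im x) (im y)) }
        ; *-cong = cong₂ _⊗_
        ; *-assoc = ⊗-assoc
        ; *-identity = ⊗-identityˡ , λ x → trans (⊗-comm x (embed 1ℚ)) (⊗-identityˡ x)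
        ; distrib = ⊗-distribˡ , λ x y z → trans (⊗-comm (y ⊕ z) x)
            (trans (⊗-distribˡ x y z) (cong₂ _⊕_ (⊗-comm x y) (⊗-comm x z)))
        }
      ; *-comm = ⊗-comm
      }

ℚ[i]-commutativeRing : CommutativeRing 0ℓ 0ℓ
ℚ[i]-commutativeRing = record { isCommutativeRing = ℚ[i]-isCommutativeRing }

-- This norm is rational-valued and submultiplicative, and it is equivalent to
-- the modulus: |z| ≤ ‖ z ‖ ≤ √2 |z|.
‖_‖ : ℚ[i] → ℚ
‖ a +i b ‖ = ∣ a ∣ ℚ.+ ∣ b ∣

dist : ℚ[i] → ℚ[i] → ℚ
dist z w = ‖ z ⊕ ⊖ w ‖

module _ where
  open CommutativeRing ℚ[i]-commutativeRing
    using (ring; +-abelianGroup; +-assoc; +-identityʳ; +-identityˡ; -‿inverseʳ; -‿inverseˡ; distribˡ; distribʳ; +-commutativeSemigroup)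
  private
    module RP = RingProperties ring

  opaque
    private
      expand : ∀ a b c d → (a ℚ.* c ℚ.+ b ℚ.* d) ℚ.+ (a ℚ.* d ℚ.+ b ℚ.* c) ≡ (a ℚ.+ b) ℚ.* (c ℚ.+ d)
      expand = solve 4 (λ a b c d → (a :* c :+ b :* d) :+ (a :* d :+ b :* c) := (a :+ b) :* (c :+ d)) refl
      exchange : ∀ a b c d → (a ℚ.+ c) ℚ.+ (b ℚ.+ d) ≡ (a ℚ.+ b) ℚ.+ (c ℚ.+ d)
      exchange = solve 4 (λ a b c d → (a :+ c) :+ (b :+ d) := (a :+ b) :+ (c :+ d)) refl

    0≤‖‖ : ∀ z → 0ℚ ℚ.≤ ‖ z ‖
    0≤‖‖ (a +i b) = ℚ.+-mono-≤ (ℚ.0≤∣p∣ a) (ℚ.0≤∣p∣ b)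

    ‖⊕‖ : ∀ z w → ‖ z ⊕ w ‖ ℚ.≤ ‖ z ‖ ℚ.+ ‖ w ‖
    ‖⊕‖ (a +i b) (c +i d) = ℚ.≤-trans
      (ℚ.+-mono-≤ (ℚ.∣p+q∣≤∣p∣+∣q∣ a c) (ℚ.∣p+q∣≤∣p∣+∣q∣ b d))
      (ℚ.≤-reflexive (exchange (∣ a ∣) (∣ b ∣) (∣ c ∣) (∣ d ∣)))

    ‖⊖‖ : ∀ z → ‖ ⊖ z ‖ ≡ ‖ z ‖
    ‖⊖‖ (a +i b) = cong₂ ℚ._+_ (ℚ.∣-p∣≡∣p∣ a) (ℚ.∣-p∣≡∣p∣ b)

    ‖⊗‖ : ∀ z w → ‖ z ⊗ w ‖ ℚ.≤ ‖ z ‖ ℚ.* ‖ w ‖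
    ‖⊗‖ (a +i b) (c +i d) = ℚ.≤-trans
      (ℚ.+-mono-≤ (ℚ.∣p-q∣≤∣p∣+∣q∣ (a ℚ.* c) (b ℚ.* d)) (ℚ.∣p+q∣≤∣p∣+∣q∣ (a ℚ.* d) (b ℚ.* c)))
      (ℚ.≤-reflexive (trans
        (cong₂ ℚ._+_
          (cong₂ ℚ._+_ (ℚ.∣p*q∣≡∣p∣*∣q∣ a c) (ℚ.∣p*q∣≡∣p∣*∣q∣ b d))
          (cong₂ ℚ._+_ (ℚ.∣p*q∣≡∣p∣*∣q∣ a d) (ℚ.∣p*q∣≡∣p∣*∣q∣ b c)))
        (expand (∣ a ∣) (∣ b ∣) (∣ c ∣) (∣ d ∣))))

    ‖•‖ : ∀ q z → 0ℚ ℚ.≤ q → ‖ q • z ‖ ≡ q ℚ.* ‖ z ‖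
    ‖•‖ q (a +i b) 0≤q = trans
      (cong₂ ℚ._+_ (trans (ℚ.∣p*q∣≡∣p∣*∣q∣ q a) (cong (ℚ._* ∣ a ∣) (ℚ.0≤p⇒∣p∣≡p 0≤q)))
                   (trans (ℚ.∣p*q∣≡∣p∣*∣q∣ q b) (cong (ℚ._* ∣ b ∣) (ℚ.0≤p⇒∣p∣≡p 0≤q))))
      (sym (ℚ.*-distribˡ-+ q (∣ a ∣) (∣ b ∣)))

    ‖embed‖ : ∀ {q} → 0ℚ ℚ.≤ q → ‖ embed q ‖ ≡ q
    ‖embed‖ {q} 0≤q = trans (ℚ.+-identityʳ ∣ q ∣) (ℚ.0≤p⇒∣p∣≡p 0≤q)

    dist-refl : ∀ z → dist z z ≡ 0ℚ
    dist-refl z = cong ‖_‖ {x = z ⊕ ⊖ z} {y = embed 0ℚ} (-‿inverseʳ z)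

    dist-sym : ∀ z w → dist z w ≡ dist w z
    dist-sym z w = trans (sym (‖⊖‖ (z ⊕ ⊖ w))) (cong ‖_‖ (⁻¹-anti-homo-// z w))
      where open GroupProperties (CommutativeRing.+-group ℚ[i]-commutativeRing)

    triangle : ∀ x y z → dist x z ℚ.≤ dist x y ℚ.+ dist y z
    triangle x y z = subst (λ t → ‖ t ‖ ℚ.≤ dist x y ℚ.+ dist y z) eq (‖⊕‖ (x ⊕ ⊖ y) (y ⊕ ⊖ z))
      where
      eq : (x ⊕ ⊖ y) ⊕ (y ⊕ ⊖ z) ≡ x ⊕ ⊖ z
      eq = trans (+-assoc x (⊖ y) (y ⊕ ⊖ z)) (cong (x ⊕_)
        (trans (sym (+-assoc (⊖ y) y (⊖ z))) (trans (cong (_⊕ ⊖ z) (-‿inverseˡ y)) (+-identityˡ (⊖ z)))))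

    dist-⊕ : ∀ x y x′ y′ → dist (x ⊕ y) (x′ ⊕ y′) ℚ.≤ dist x x′ ℚ.+ dist y y′
    dist-⊕ x y x′ y′ = subst (λ t → ‖ t ‖ ℚ.≤ dist x x′ ℚ.+ dist y y′) eq (‖⊕‖ (x ⊕ ⊖ x′) (y ⊕ ⊖ y′))
      where
      open CommutativeSemigroupProperties +-commutativeSemigroup using (interchange)
      eq : (x ⊕ ⊖ x′) ⊕ (y ⊕ ⊖ y′) ≡ (x ⊕ y) ⊕ ⊖ (x′ ⊕ y′)
      eq = trans (interchange x (⊖ x′) y (⊖ y′)) (cong ((x ⊕ y) ⊕_) (RP.-‿+-comm x′ y′))

    dist-⊖ : ∀ x y → dist (⊖ x) (⊖ y) ≡ dist x y
    dist-⊖ x y = trans (cong ‖_‖ (RP.-‿+-comm x (⊖ y))) (‖⊖‖ (x ⊕ ⊖ y))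

    dist-⊗ : ∀ x y x′ y′ → dist (x ⊗ y) (x′ ⊗ y′) ℚ.≤ ‖ x ‖ ℚ.* dist y y′ ℚ.+ dist x x′ ℚ.* ‖ y′ ‖
    dist-⊗ x y x′ y′ = ℚ.≤-trans (triangle (x ⊗ y) (x ⊗ y′) (x′ ⊗ y′)) (ℚ.+-mono-≤
      (subst (λ t → ‖ t ‖ ℚ.≤ ‖ x ‖ ℚ.* dist y y′)
        (trans (distribˡ x y (⊖ y′)) (cong ((x ⊗ y) ⊕_) (sym (RP.-‿distribʳ-* x y′))))
        (‖⊗‖ x (y ⊕ ⊖ y′)))
      (subst (λ t → ‖ t ‖ ℚ.≤ dist x x′ ℚ.* ‖ y′ ‖)
        (trans (distribʳ y′ x (⊖ x′)) (cong ((x ⊗ y′) ⊕_) (sym (RP.-‿distribˡ-* x′ y′))))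
        (‖⊗‖ (x ⊕ ⊖ x′) y′)))

    dist-• : ∀ q x y → 0ℚ ℚ.≤ q → dist (q • x) (q • y) ≡ q ℚ.* dist x y
    dist-• q x y 0≤q = trans (cong ‖_‖ (cong₂ _+i_ (eq (re x) (re y)) (eq (im x) (im y))))
      (‖•‖ q (x ⊕ ⊖ y) 0≤q)
      where
      eq : ∀ a b → q ℚ.* a ℚ.+ ℚ.- (q ℚ.* b) ≡ q ℚ.* (a ℚ.+ ℚ.- b)
      eq a b = trans (cong (q ℚ.* a ℚ.+_) (ℚ.neg-distribʳ-* q b)) (sym (ℚ.*-distribˡ-+ q a (ℚ.- b)))

    dist-⊕ˡ : ∀ x t y → dist (x ⊕ t) y ℚ.≤ dist x y ℚ.+ ‖ t ‖
    dist-⊕ˡ x t y = subst₂ (λ u v → dist (x ⊕ t) u ℚ.≤ dist x y ℚ.+ v)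
      (+-identityʳ y) (cong ‖_‖ (+-identityʳ t)) (dist-⊕ x t y (embed 0ℚ))

    ‖‖≤ : ∀ x y → ‖ x ‖ ℚ.≤ dist x y ℚ.+ ‖ y ‖
    ‖‖≤ x y = subst (λ t → ‖ t ‖ ℚ.≤ dist x y ℚ.+ ‖ y ‖)
      (trans (+-assoc x (⊖ y) y) (trans (cong (x ⊕_) (-‿inverseˡ y)) (+-identityʳ x)))
      (‖⊕‖ (x ⊕ ⊖ y) y)

Cauchy : (ℕ → ℚ[i]) → Set
Cauchy s = ∀ {ε} → 0ℚ ℚ.< ε → ∃[ N ] ∀ m n → N ℕ.≤ m → N ℕ.≤ n → dist (s m) (s n) ℚ.≤ ε

-- ℂ is the completion of ℚ(i): Cauchy sequences up to _≈ᶜ_.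
record ℂ : Set where
  constructor mkℂ
  field
    seq    : ℕ → ℚ[i]
    cauchy : Cauchy seq

open ℂ

infix 4 _≈ᶜ_
record _≈ᶜ_ (x y : ℂ) : Set where
  constructor mk≈
  field
    close : ∀ {ε} → 0ℚ ℚ.< ε → ∃[ N ] ∀ n → N ℕ.≤ n → dist (seq x n) (seq y n) ℚ.≤ ε

open _≈ᶜ_

opaque

  ≤ε : ∀ {p q ε} → p ℚ.≤ ½ ℚ.* ε → q ℚ.≤ ½ ℚ.* ε → p ℚ.+ q ℚ.≤ ε
  ≤ε {ε = ε} p≤ q≤ = ℚ.≤-trans (ℚ.+-mono-≤ p≤ q≤) (ℚ.≤-reflexive (halves ε))

  pointwise : ∀ {x y} → (∀ n → seq x n ≡ seq y n) → x ≈ᶜ y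
  pointwise {x} {y} eq .close 0<ε = 0 , λ n _ →
    ℚ.≤-trans (ℚ.≤-reflexive (trans (cong (dist (seq x n)) (sym (eq n))) (dist-refl (seq x n)))) (ℚ.<⇒≤ 0<ε)

  ≈ᶜ-sym : ∀ {x y} → x ≈ᶜ y → y ≈ᶜ x
  ≈ᶜ-sym {x} {y} x≈y .close {ε} 0<ε with close x≈y 0<ε
  ... | N , p = N , λ n N≤n → subst (ℚ._≤ ε) (dist-sym (seq x n) (seq y n)) (p n N≤n)

  ≈ᶜ-trans : ∀ {x y z} → x ≈ᶜ y → y ≈ᶜ z → x ≈ᶜ z
  ≈ᶜ-trans {x} {y} {z} x≈y y≈z .close 0<ε with close x≈y (0<½* 0<ε) | close y≈z (0<½* 0<ε)
  ... | M , p | N , q = M ℕ.⊔ N , λ n le → ℚ.≤-trans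
    (triangle (seq x n) (seq y n) (seq z n))
    (≤ε (p n (ℕ.m⊔n≤o⇒m≤o M N le)) (q n (ℕ.m⊔n≤o⇒n≤o M N le)))

  +-cauchy : ∀ {s t} → Cauchy s → Cauchy t → Cauchy (λ n → s n ⊕ t n)
  +-cauchy {s} {t} cs ct 0<ε with cs (0<½* 0<ε) | ct (0<½* 0<ε)
  ... | M , p | N , q = M ℕ.⊔ N , λ m n le le′ → ℚ.≤-trans
    (dist-⊕ (s m) (t m) (s n) (t n))
    (≤ε (p m n (ℕ.m⊔n≤o⇒m≤o M N le) (ℕ.m⊔n≤o⇒m≤o M N le′))
        (q m n (ℕ.m⊔n≤o⇒n≤o M N le) (ℕ.m⊔n≤o⇒n≤o M N le′)))

  -‿cauchy : ∀ {s} → Cauchy s → Cauchy (λ n → ⊖ s n)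
  -‿cauchy {s} cs {ε} 0<ε with cs 0<ε
  ... | M , p = M , λ m n le le′ → subst (ℚ._≤ ε) (sym (dist-⊖ (s m) (s n))) (p m n le le′)

  eventually-bounded : ∀ {s} → Cauchy s →
    ∃[ B ] ∃[ N ] (0ℚ ℚ.≤ B) ∧ (∀ n → N ℕ.≤ n → ‖ s n ‖ ℚ.≤ B)
  eventually-bounded {s} cs with cs (ℚ.positive⁻¹ 1ℚ)
  ... | N , p = 1ℚ ℚ.+ ‖ s N ‖ , N
    , ℚ.+-mono-≤ (ℚ.nonNegative⁻¹ 1ℚ) (0≤‖‖ (s N))
    , λ n le → ℚ.≤-trans (‖‖≤ (s n) (s N)) (ℚ.+-monoˡ-≤ ‖ s N ‖ (p n N le ℕ.≤-refl))

  product-estimate : ∀ {b b′ δ δ′ ε} x y x′ y′ → 0ℚ ℚ.≤ b → 0ℚ ℚ.≤ δ′ →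
    ‖ x ‖ ℚ.≤ b → ‖ y′ ‖ ℚ.≤ b′ → dist x x′ ℚ.≤ δ′ → dist y y′ ℚ.≤ δ →
    b ℚ.* δ ℚ.≤ ½ ℚ.* ε → b′ ℚ.* δ′ ℚ.≤ ½ ℚ.* ε → dist (x ⊗ y) (x′ ⊗ y′) ℚ.≤ ε
  product-estimate {b} {b′} {δ} {δ′} x y x′ y′ 0≤b 0≤δ′ x≤ y′≤ x~ y~ small small′ = ℚ.≤-trans
    (dist-⊗ x y x′ y′)
    (≤ε (ℚ.≤-trans (*-mono 0≤b (0≤‖‖ (y ⊕ ⊖ y′)) x≤ y~) small)
        (ℚ.≤-trans (*-mono 0≤δ′ (0≤‖‖ y′) x~ y′≤) (subst (ℚ._≤ _) (ℚ.*-comm b′ δ′) small′)))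

  *-cauchy : ∀ {s t} → Cauchy s → Cauchy t → Cauchy (λ n → s n ⊗ t n)
  *-cauchy {s} {t} cs ct 0<ε with eventually-bounded {s} cs | eventually-bounded {t} ct
  ... | B , K , 0≤B , s≤B | B′ , K′ , 0≤B′ , t≤B′ with shrink B (0<½* 0<ε) | shrink B′ (0<½* 0<ε)
  ... | δ , 0<δ , Bδ≤ | δ′ , 0<δ′ , B′δ′≤ with cs 0<δ′ | ct 0<δ
  ... | M , p | N , q = (K ℕ.⊔ K′) ℕ.⊔ (M ℕ.⊔ N) , λ m n le le′ →
    product-estimate (s m) (t m) (s n) (t n) 0≤B (ℚ.<⇒≤ 0<δ′)
      (s≤B m (ℕ.m⊔n≤o⇒m≤o K K′ (l le))) (t≤B′ n (ℕ.m⊔n≤o⇒n≤o K K′ (l le′)))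
      (p m n (ℕ.m⊔n≤o⇒m≤o M N (r le)) (ℕ.m⊔n≤o⇒m≤o M N (r le′)))
      (q m n (ℕ.m⊔n≤o⇒n≤o M N (r le)) (ℕ.m⊔n≤o⇒n≤o M N (r le′)))
      Bδ≤ B′δ′≤
    where
    l : ∀ {o} → (K ℕ.⊔ K′) ℕ.⊔ (M ℕ.⊔ N) ℕ.≤ o → K ℕ.⊔ K′ ℕ.≤ o
    l = ℕ.m⊔n≤o⇒m≤o (K ℕ.⊔ K′) (M ℕ.⊔ N)
    r : ∀ {o} → (K ℕ.⊔ K′) ℕ.⊔ (M ℕ.⊔ N) ℕ.≤ o → M ℕ.⊔ N ℕ.≤ o
    r = ℕ.m⊔n≤o⇒n≤o (K ℕ.⊔ K′) (M ℕ.⊔ N)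

  constant-cauchy : ∀ z → Cauchy (λ _ → z)
  constant-cauchy z 0<ε = 0 , λ _ _ _ _ → ℚ.≤-trans (ℚ.≤-reflexive (dist-refl z)) (ℚ.<⇒≤ 0<ε)

infixl 6 _+ᶜ_
infixl 7 _*ᶜ_
infix  8 -ᶜ_

_+ᶜ_ _*ᶜ_ : ℂ → ℂ → ℂ
x +ᶜ y = mkℂ (λ n → seq x n ⊕ seq y n) (+-cauchy {seq x} {seq y} (cauchy x) (cauchy y))
x *ᶜ y = mkℂ (λ n → seq x n ⊗ seq y n) (*-cauchy {seq x} {seq y} (cauchy x) (cauchy y))

-ᶜ_ : ℂ → ℂ
-ᶜ x = mkℂ (λ n → ⊖ seq x n) (-‿cauchy {seq x} (cauchy x))

fromℚ[i] : ℚ[i] → ℂ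
fromℚ[i] z = mkℂ (λ _ → z) (constant-cauchy z)

fromℚ : ℚ → ℂ
fromℚ q = fromℚ[i] (embed q)

opaque

  +-cong : ∀ {x x′ y y′} → x ≈ᶜ x′ → y ≈ᶜ y′ → x +ᶜ y ≈ᶜ x′ +ᶜ y′
  +-cong {x} {x′} {y} {y′} x≈ y≈ .close 0<ε with close x≈ (0<½* 0<ε) | close y≈ (0<½* 0<ε)
  ... | M , p | N , q = M ℕ.⊔ N , λ n le → ℚ.≤-trans
    (dist-⊕ (seq x n) (seq y n) (seq x′ n) (seq y′ n))
    (≤ε (p n (ℕ.m⊔n≤o⇒m≤o M N le)) (q n (ℕ.m⊔n≤o⇒n≤o M N le)))

  -‿cong : ∀ {x y} → x ≈ᶜ y → -ᶜ x ≈ᶜ -ᶜ y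
  -‿cong {x} {y} x≈y .close {ε} 0<ε with close x≈y 0<ε
  ... | M , p = M , λ n le → subst (ℚ._≤ ε) (sym (dist-⊖ (seq x n) (seq y n))) (p n le)

  *-cong : ∀ {x x′ y y′} → x ≈ᶜ x′ → y ≈ᶜ y′ → x *ᶜ y ≈ᶜ x′ *ᶜ y′
  *-cong {x} {x′} {y} {y′} x≈ y≈ .close 0<ε
    with eventually-bounded {seq x} (cauchy x) | eventually-bounded {seq y′} (cauchy y′)
  ... | B , K , 0≤B , x≤B | B′ , K′ , 0≤B′ , y≤B′ with shrink B (0<½* 0<ε) | shrink B′ (0<½* 0<ε)
  ... | δ , 0<δ , Bδ≤ | δ′ , 0<δ′ , B′δ′≤ with close x≈ 0<δ′ | close y≈ 0<δ
  ... | M , p | N , q = (K ℕ.⊔ K′) ℕ.⊔ (M ℕ.⊔ N) , λ n le →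
    product-estimate (seq x n) (seq y n) (seq x′ n) (seq y′ n) 0≤B (ℚ.<⇒≤ 0<δ′)
      (x≤B n (ℕ.m⊔n≤o⇒m≤o K K′ (ℕ.m⊔n≤o⇒m≤o (K ℕ.⊔ K′) (M ℕ.⊔ N) le)))
      (y≤B′ n (ℕ.m⊔n≤o⇒n≤o K K′ (ℕ.m⊔n≤o⇒m≤o (K ℕ.⊔ K′) (M ℕ.⊔ N) le)))
      (p n (ℕ.m⊔n≤o⇒m≤o M N (ℕ.m⊔n≤o⇒n≤o (K ℕ.⊔ K′) (M ℕ.⊔ N) le)))
      (q n (ℕ.m⊔n≤o⇒n≤o M N (ℕ.m⊔n≤o⇒n≤o (K ℕ.⊔ K′) (M ℕ.⊔ N) le)))
      Bδ≤ B′δ′≤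

  private
    module Q = CommutativeRing ℚ[i]-commutativeRing

  ℂ-isCommutativeRing : IsCommutativeRing _≈ᶜ_ _+ᶜ_ _*ᶜ_ -ᶜ_ (fromℚ 0ℚ) (fromℚ 1ℚ)
  ℂ-isCommutativeRing = record
    { isRing = record
      { +-isAbelianGroup = record
        { isGroup = record
          { isMonoid = record
            { isSemigroup = record
              { isMagma = record
                { isEquivalence = record
                  { refl = pointwise (λ _ → refl) ; sym = ≈ᶜ-sym ; trans = ≈ᶜ-trans }
                ; ∙-cong = +-cong }
              ; assoc = λ x y z → pointwise λ n → Q.+-assoc (seq x n) (seq y n) (seq z n) }
            ; identity = (λ x → pointwise λ n → Q.+-identityˡ (seq x n))
                       , (λ x → pointwise λ n → Q.+-identityʳ (seq x n)) }
          ; inverse = (λ x → pointwise λ n → Q.-‿inverseˡ (seq x n))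
                    , (λ x → pointwise λ n → Q.-‿inverseʳ (seq x n))
          ; ⁻¹-cong = -‿cong }
        ; comm = λ x y → pointwise λ n → Q.+-comm (seq x n) (seq y n) }
      ; *-cong = *-cong
      ; *-assoc = λ x y z → pointwise λ n → Q.*-assoc (seq x n) (seq y n) (seq z n)
      ; *-identity = (λ x → pointwise λ n → Q.*-identityˡ (seq x n))
                   , (λ x → pointwise λ n → Q.*-identityʳ (seq x n))
      ; distrib = (λ x y z → pointwise λ n → Q.distribˡ (seq x n) (seq y n) (seq z n))
                , (λ x y z → pointwise λ n → Q.distribʳ (seq x n) (seq y n) (seq z n))
      }
    ; *-comm = λ x y → pointwise λ n → Q.*-comm (seq x n) (seq y n)
    }

ℂ-commutativeRing : CommutativeRing 0ℓ 0ℓ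
ℂ-commutativeRing = record { isCommutativeRing = ℂ-isCommutativeRing }

partialᵍ : (ℕ → ℚ[i]) → ℕ → ℚ[i]
partialᵍ t zero    = embed 0ℚ
partialᵍ t (suc n) = partialᵍ t n ⊕ t n

opaque

  partialᵍ-dist : ∀ {t c} → (∀ j → ‖ t j ‖ ℚ.≤ c j) → ∀ n k →
    dist (partialᵍ t (k ℕ.+ n)) (partialᵍ t n) ℚ.+ partial c n ℚ.≤ partial c (k ℕ.+ n)
  partialᵍ-dist {t} {c} t≤c n zero = ℚ.≤-reflexive
    (trans (cong (ℚ._+ partial c n) (dist-refl (partialᵍ t n))) (ℚ.+-identityˡ (partial c n)))
  partialᵍ-dist {t} {c} t≤c n (suc k) = ℚ.≤-trans
    (ℚ.+-monoˡ-≤ (partial c n) (dist-⊕ˡ (partialᵍ t (k ℕ.+ n)) (t (k ℕ.+ n)) (partialᵍ t n)))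
    (ℚ.≤-trans (ℚ.≤-reflexive (swap (dist (partialᵍ t (k ℕ.+ n)) (partialᵍ t n)) ‖ t (k ℕ.+ n) ‖ (partial c n)))
      (ℚ.+-mono-≤ (partialᵍ-dist t≤c n k) (t≤c (k ℕ.+ n))))
    where
    swap : ∀ x y z → (x ℚ.+ y) ℚ.+ z ≡ (x ℚ.+ z) ℚ.+ y
    swap = solve 3 (λ x y z → (x :+ y) :+ z := (x :+ z) :+ y) refl

  partialᵍ-cauchy : ∀ {c} → Halving c → ∀ {ε} → 0ℚ ℚ.< ε →
    ∃[ N ] ∀ {t} → (∀ j → ‖ t j ‖ ℚ.≤ c j) → ∀ m n → N ℕ.≤ m → N ℕ.≤ n →
      dist (partialᵍ t m) (partialᵍ t n) ℚ.≤ ε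
  partialᵍ-cauchy {c} H {ε} 0<ε with tails-vanish H (0<½* 0<ε)
  ... | N , small = N , λ {t} t≤c m n N≤m N≤n → ℚ.≤-trans
      (triangle (partialᵍ t m) (partialᵍ t N) (partialᵍ t n))
      (≤ε (from-N t≤c m N≤m)
        (subst (ℚ._≤ ½ ℚ.* ε) (dist-sym (partialᵍ t n) (partialᵍ t N)) (from-N t≤c n N≤n)))
    where
    cancel : ∀ d s → d ℚ.+ s ℚ.≤ s ℚ.+ ½ ℚ.* ε → d ℚ.≤ ½ ℚ.* ε
    cancel d s le = subst₂ ℚ._≤_ (undo d) (undo (½ ℚ.* ε))
      (ℚ.+-monoˡ-≤ (ℚ.- s) (subst (d ℚ.+ s ℚ.≤_) (ℚ.+-comm s (½ ℚ.* ε)) le))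
      where
      undo : ∀ x → (x ℚ.+ s) ℚ.+ ℚ.- s ≡ x
      undo x = trans (ℚ.+-assoc x s (ℚ.- s)) (trans (cong (x ℚ.+_) (ℚ.+-inverseʳ s)) (ℚ.+-identityʳ x))
    from-N : ∀ {t} → (∀ j → ‖ t j ‖ ℚ.≤ c j) → ∀ m → N ℕ.≤ m →
      dist (partialᵍ t m) (partialᵍ t N) ℚ.≤ ½ ℚ.* ε
    from-N {t} t≤c m N≤m = subst (λ m → dist (partialᵍ t m) (partialᵍ t N) ℚ.≤ ½ ℚ.* ε)
      (ℕ.m∸n+n≡m N≤m)
      (cancel _ (partial c N)
        (ℚ.≤-trans (partialᵍ-dist t≤c N (m ∸ N)) (small N (m ∸ N) ℕ.≤-refl)))

  fromℕ-+ : ∀ m n → fromℕ (m ℕ.+ n) ≡ fromℕ m ℚ.+ fromℕ n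
  fromℕ-+ zero    n = sym (ℚ.+-identityˡ (fromℕ n))
  fromℕ-+ (suc m) n = trans (fromℕ-suc (m ℕ.+ n))
    (trans (cong (1ℚ ℚ.+_) (fromℕ-+ m n))
      (trans (sym (ℚ.+-assoc 1ℚ (fromℕ m) (fromℕ n))) (cong (ℚ._+ fromℕ n) (sym (fromℕ-suc m)))))

-- expTerm z j = z ^ j / j !
expTerm : ℚ[i] → ℕ → ℚ[i]
expTerm z zero    = embed 1ℚ
expTerm z (suc j) = recip j • (expTerm z j ⊗ z)

majorant : ℕ → ℕ → ℚ
majorant m zero    = 1ℚ
majorant m (suc j) = recip j ℚ.* (majorant m j ℚ.* fromℕ m)

opaque

  majorant-nonneg : ∀ m j → 0ℚ ℚ.≤ majorant m j
  majorant-nonneg m zero    = ℚ.nonNegative⁻¹ 1ℚ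
  majorant-nonneg m (suc j) = 0≤* (0≤recip j) (0≤* (majorant-nonneg m j) (0≤fromℕ m))

  majorant-halving : ∀ m → Halving (majorant m)
  majorant-halving m = record
    { nonneg = majorant-nonneg m
    ; start  = m ℕ.+ m
    ; halve  = λ j m+m≤j → ℚ.≤-trans
        (ℚ.≤-reflexive (collect (recip j) (majorant m j) (fromℕ m)))
        (≤-recip j (subst (majorant m j ℚ.* (fromℕ m ℚ.+ fromℕ m) ℚ.≤_) (ℚ.*-comm (majorant m j) (fromℕ (suc j)))
          (ℚ.*-monoˡ-≤-nonNeg (majorant m j) {{ℚ.nonNegative (majorant-nonneg m j)}}
            (subst (ℚ._≤ fromℕ (suc j)) (fromℕ-+ m m) (fromℕ-mono (ℕ.m≤n⇒m≤1+n m+m≤j))))))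
    }
    where
    collect : ∀ r c n → r ℚ.* (c ℚ.* n) ℚ.+ r ℚ.* (c ℚ.* n) ≡ r ℚ.* (c ℚ.* (n ℚ.+ n))
    collect = solve 3 (λ r c n → r :* (c :* n) :+ r :* (c :* n) := r :* (c :* (n :+ n))) refl

  expTerm-bound : ∀ {z} m → ‖ z ‖ ℚ.≤ fromℕ m → ∀ j → ‖ expTerm z j ‖ ℚ.≤ majorant m j
  expTerm-bound m z≤ zero = ℚ.≤-refl
  expTerm-bound {z} m z≤ (suc j) = subst (ℚ._≤ majorant m (suc j))
    (sym (‖•‖ (recip j) (expTerm z j ⊗ z) (0≤recip j)))
    (ℚ.*-monoˡ-≤-nonNeg (recip j) {{ℚ.nonNegative (0≤recip j)}}
      (ℚ.≤-trans (‖⊗‖ (expTerm z j) z)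
        (*-mono (majorant-nonneg m j) (0≤‖‖ z) (expTerm-bound m z≤ j) z≤)))

  expTerm-lipschitz : ∀ {z w B} m → ‖ z ‖ ℚ.≤ B → ‖ w ‖ ℚ.≤ B → 1ℚ ℚ.+ B ℚ.≤ fromℕ m → ∀ j →
    dist (expTerm z j) (expTerm w j) ℚ.≤ majorant m j ℚ.* dist z w
  expTerm-lipschitz {z} {w} m z≤ w≤ 1+B≤ zero =
    ℚ.≤-trans (ℚ.≤-reflexive (dist-refl (embed 1ℚ))) (0≤* (ℚ.nonNegative⁻¹ 1ℚ) (0≤‖‖ (z ⊕ ⊖ w)))
  expTerm-lipschitz {z} {w} {B} m z≤ w≤ 1+B≤ (suc j) =
    subst₂ ℚ._≤_
      (sym (dist-• (recip j) (expTerm z j ⊗ z) (expTerm w j ⊗ w) (0≤recip j)))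
      (sym (ℚ.*-assoc (recip j) (c ℚ.* fromℕ m) d))
      (ℚ.*-monoˡ-≤-nonNeg (recip j) {{ℚ.nonNegative (0≤recip j)}}
        (ℚ.≤-trans (dist-⊗ (expTerm z j) z (expTerm w j) w)
          (ℚ.≤-trans
            (ℚ.+-mono-≤
              (ℚ.*-monoʳ-≤-nonNeg d (expTerm-bound m z≤m j))
              (*-mono (0≤* (majorant-nonneg m j) (0≤‖‖ (z ⊕ ⊖ w))) (0≤‖‖ w)
                (expTerm-lipschitz m z≤ w≤ 1+B≤ j) w≤))
            (ℚ.≤-trans
              (ℚ.≤-reflexive (trans
                (cong (ℚ._+ (c ℚ.* d) ℚ.* B) (cong (ℚ._* d) (sym (ℚ.*-identityʳ c))))
                (collect c d 1ℚ B)))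
              (ℚ.*-monoʳ-≤-nonNeg d
                (ℚ.*-monoˡ-≤-nonNeg c {{ℚ.nonNegative (majorant-nonneg m j)}} 1+B≤))))))
    where
    c d : ℚ
    c = majorant m j
    d = dist z w
    instance
      d≥0 : ℚ.NonNegative d
      d≥0 = ℚ.nonNegative (0≤‖‖ (z ⊕ ⊖ w))
    z≤m : ‖ z ‖ ℚ.≤ fromℕ m
    z≤m = ℚ.≤-trans z≤ (ℚ.≤-trans (subst (ℚ._≤ 1ℚ ℚ.+ B) (ℚ.+-identityˡ B) (ℚ.+-monoˡ-≤ B (ℚ.nonNegative⁻¹ 1ℚ))) 1+B≤)
    collect : ∀ c d o b → (c ℚ.* o) ℚ.* d ℚ.+ (c ℚ.* d) ℚ.* b ≡ (c ℚ.* (o ℚ.+ b)) ℚ.* d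
    collect = solve 4 (λ c d o b → (c :* o) :* d :+ (c :* d) :* b := (c :* (o :+ b)) :* d) refl

  expSum-lipschitz : ∀ {z w B} m → ‖ z ‖ ℚ.≤ B → ‖ w ‖ ℚ.≤ B → 1ℚ ℚ.+ B ℚ.≤ fromℕ m → ∀ n →
    dist (partialᵍ (expTerm z) n) (partialᵍ (expTerm w) n) ℚ.≤ partial (majorant m) n ℚ.* dist z w
  expSum-lipschitz {z} {w} m z≤ w≤ 1+B≤ zero =
    ℚ.≤-reflexive (trans (dist-refl (embed 0ℚ)) (sym (ℚ.*-zeroˡ (dist z w))))
  expSum-lipschitz {z} {w} m z≤ w≤ 1+B≤ (suc n) = ℚ.≤-trans
    (dist-⊕ (partialᵍ (expTerm z) n) (expTerm z n) (partialᵍ (expTerm w) n) (expTerm w n))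
    (ℚ.≤-trans
      (ℚ.+-mono-≤ (expSum-lipschitz m z≤ w≤ 1+B≤ n) (expTerm-lipschitz m z≤ w≤ 1+B≤ n))
      (ℚ.≤-reflexive (sym (ℚ.*-distribʳ-+ (dist z w) (partial (majorant m) n) (majorant m n)))))

  exp-cauchy : ∀ {s} → Cauchy s → Cauchy (λ n → partialᵍ (expTerm (s n)) n)
  exp-cauchy {s} cs {ε} 0<ε with eventually-bounded {s} cs
  ... | B , K , 0≤B , s≤B with ceil (1ℚ ℚ.+ B)
  ... | k , 1+B≤ with shrink (bound (majorant-halving (suc k))) (0<½* 0<ε)
                    | partialᵍ-cauchy (majorant-halving (suc k)) (0<½* 0<ε)
  ... | δ , 0<δ , bδ≤ | L , tails with cs 0<δ
  ... | M , p = (K ℕ.⊔ L) ℕ.⊔ M , λ m n le le′ → ℚ.≤-trans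
      (triangle (partialᵍ (expTerm (s m)) m) (partialᵍ (expTerm (s n)) m) (partialᵍ (expTerm (s n)) n))
      (≤ε
        (ℚ.≤-trans (expSum-lipschitz (suc k) (s≤B m (K≤ le)) (s≤B n (K≤ le′)) 1+B≤ m)
          (ℚ.≤-trans
            (*-mono
              (ℚ.≤-trans (ℚ.≤-reflexive refl) (partial≤bound H 0))
              (0≤‖‖ (s m ⊕ ⊖ s n))
              (partial≤bound H m)
              (p m n (ℕ.m⊔n≤o⇒n≤o (K ℕ.⊔ L) M le) (ℕ.m⊔n≤o⇒n≤o (K ℕ.⊔ L) M le′)))
            bδ≤))
        (tails (expTerm-bound (suc k) (ℚ.≤-trans (s≤B n (K≤ le′)) B≤)) m n (L≤ le) (L≤ le′)))
    where
    H : Halving (majorant (suc k))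
    H = majorant-halving (suc k)
    K≤ : ∀ {o} → (K ℕ.⊔ L) ℕ.⊔ M ℕ.≤ o → K ℕ.≤ o
    K≤ le = ℕ.m⊔n≤o⇒m≤o K L (ℕ.m⊔n≤o⇒m≤o (K ℕ.⊔ L) M le)
    L≤ : ∀ {o} → (K ℕ.⊔ L) ℕ.⊔ M ℕ.≤ o → L ℕ.≤ o
    L≤ le = ℕ.m⊔n≤o⇒n≤o K L (ℕ.m⊔n≤o⇒m≤o (K ℕ.⊔ L) M le)
    B≤ : B ℚ.≤ fromℕ (suc k)
    B≤ = ℚ.≤-trans (subst (ℚ._≤ 1ℚ ℚ.+ B) (ℚ.+-identityˡ B) (ℚ.+-monoˡ-≤ B (ℚ.nonNegative⁻¹ 1ℚ))) 1+B≤

-- exp x is the limit of the diagonal sequence whose n-th entry is the sum of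
-- (x n) ^ j / j ! over j < n.
exp : ℂ → ℂ
exp x = mkℂ (λ n → partialᵍ (expTerm (seq x n)) n) (exp-cauchy {seq x} (cauchy x))

½^1+ : ℕ → ℚ
½^1+ zero    = ½
½^1+ (suc n) = ½ ℚ.* ½^1+ n

-- log2Term j = 1 / ((j + 1) 2 ^ (j + 1))
log2Term : ℕ → ℚ
log2Term j = recip j ℚ.* ½^1+ j

opaque

  ½^1+-nonneg : ∀ j → 0ℚ ℚ.≤ ½^1+ j
  ½^1+-nonneg zero    = ℚ.nonNegative⁻¹ ½
  ½^1+-nonneg (suc j) = 0≤* (ℚ.nonNegative⁻¹ ½) (½^1+-nonneg j)

  recip-antimono : ∀ j → recip (suc j) ℚ.≤ recip j
  recip-antimono j = subst (ℚ._≤ recip j) (ℚ.*-identityʳ (recip (suc j)))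
    (≤-recip (suc j) (ℚ.≤-trans
      (ℚ.≤-reflexive (sym (trans (ℚ.*-comm (fromℕ (suc j)) (recip j)) (recip-inverse j))))
      (ℚ.*-monoʳ-≤-nonNeg (recip j) {{ℚ.nonNegative (0≤recip j)}} (fromℕ-mono (ℕ.n≤1+n (suc j))))))

  log2-halving : Halving log2Term
  log2-halving = record
    { nonneg = λ j → 0≤* (0≤recip j) (½^1+-nonneg j)
    ; start  = 0
    ; halve  = λ j _ → ℚ.≤-trans
        (ℚ.≤-reflexive (trans (sym (ℚ.*-distribˡ-+ (recip (suc j)) (½^1+ (suc j)) (½^1+ (suc j))))
          (cong (recip (suc j) ℚ.*_) (halves (½^1+ j)))))
        (ℚ.*-monoʳ-≤-nonNeg (½^1+ j) {{ℚ.nonNegative (½^1+-nonneg j)}} (recip-antimono j))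
    }

  log2-cauchy : Cauchy (partialᵍ (λ j → embed (log2Term j)))
  log2-cauchy 0<ε with partialᵍ-cauchy log2-halving 0<ε
  ... | N , p = N , p (λ j → ℚ.≤-reflexive (‖embed‖ (Halving.nonneg log2-halving j)))

-- log 2 = - log (1 - 1/2)
log2 : ℂ
log2 = mkℂ (partialᵍ (λ j → embed (log2Term j))) log2-cauchy

-- The map ℚ → R supplies the denominators; it is the structure map of a
-- ℚ-algebra in both uses, R = ℂ and R = ℂ[x].
module Series {c ℓ} (R : RawRing c ℓ) (fromRational : ℚ → RawRing.Carrier R) where
  open RawRing R public
  open RawSemiringDefs rawSemiring public using (_×_; _^_; sum; product)

  -- Σ≤ n f = f 0 + ... + f n
  Σ≤ : ℕ → (ℕ → Carrier) → Carrier
  Σ≤ n f = sum {suc n} (λ i → f (toℕ i))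

  falling rising : Carrier → ℕ → Carrier
  falling a m = product {m} (λ i → a + - (toℕ i × 1#))
  rising  a m = product {m} (λ i → a + toℕ i × 1#)

  invFactorial : ℕ → Carrier
  invFactorial n = fromRational (_/_ (+ 1) (n !) {{ℕ._!≢0 n}})

  binom : Carrier → ℕ → Carrier
  binom a j = falling a j * invFactorial j

  -- A power series is its sequence of coefficients.
  PowerSeries : Set c
  PowerSeries = ℕ → Carrier

  infixl 7 _⊛_ _·_
  infixr 8 _↑_

  _⊛_ : PowerSeries → PowerSeries → PowerSeries
  (f ⊛ g) n = Σ≤ n (λ i → f i * g (n ∸ i))

  _·_ : Carrier → PowerSeries → PowerSeries
  (a · f) n = a * f n

  one : PowerSeries
  one zero    = 1#
  one (suc _) = 0#

  _↑_ : PowerSeries → ℕ → PowerSeries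
  f ↑ zero  = one
  f ↑ suc n = f ⊛ f ↑ n

  -- The substitution g(f(t)), for f with zero constant term: then f ^ j has no
  -- terms of degree below j.
  _⟨_⟩ : PowerSeries → PowerSeries → PowerSeries
  (g ⟨ f ⟩) n = Σ≤ n (λ j → g j * (f ↑ j) n)

  [1+t]^_ : Carrier → PowerSeries
  [1+t]^ a = binom a

  log[1+t] : PowerSeries
  log[1+t] zero    = 0#
  log[1+t] (suc n) = (- 1#) ^ n * fromRational (recip n)

  [1+_]^-_ : ℕ → ℤ → Carrier
  [1+ n ]^- (+ k)    = fromRational (recip n) ^ k
  [1+ n ]^- -[1+ k ] = (suc n × 1#) ^ suc k

  Lif : ℤ → PowerSeries
  Lif k n = invFactorial n * [1+ n ]^- k

module Polynomial {c ℓ} (R : RawRing c ℓ) where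
  open RawRing R

  -- Coefficients in increasing degree.
  Poly : Set c
  Poly = List Carrier

  coeff : Poly → ℕ → Carrier
  coeff []      _       = 0#
  coeff (a ∷ p) zero    = a
  coeff (a ∷ p) (suc n) = coeff p n

  -- Trailing zeros are allowed, so equality is coefficientwise.
  infix 4 _≈ₚ_
  record _≈ₚ_ (p q : Poly) : Set ℓ where
    constructor mk≈ₚ
    field
      coeff-≈ : ∀ n → coeff p n ≈ coeff q n

  infixl 6 _+ₚ_
  infixl 7 _*ₚ_

  _+ₚ_ _*ₚ_ : Poly → Poly → Poly
  []      +ₚ q       = q
  (a ∷ p) +ₚ []      = a ∷ p
  (a ∷ p) +ₚ (b ∷ q) = a + b ∷ p +ₚ q

  []      *ₚ q = []
  (a ∷ p) *ₚ q = map (a *_) q +ₚ (0# ∷ p *ₚ q)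

  const : Carrier → Poly
  const a = a ∷ []

  X : Poly
  X = 0# ∷ 1# ∷ []

  eval : Poly → Carrier → Carrier
  eval []      a = 0#
  eval (b ∷ p) a = b + a * eval p a

  polynomialRing : RawRing c ℓ
  polynomialRing = record
    { Carrier = Poly
    ; _≈_ = _≈ₚ_
    ; _+_ = _+ₚ_
    ; _*_ = _*ₚ_
    ; -_  = map -_
    ; 0#  = []
    ; 1#  = const 1#
    }

ℂ-rawRing : RawRing 0ℓ 0ℓ
ℂ-rawRing = CommutativeRing.rawRing ℂ-commutativeRing

module ℂ[[t]] = Series ℂ-rawRing fromℚ

open Polynomial ℂ-rawRing public

module ℂ[x][[t]] = Series polynomialRing (λ q → const (fromℚ q))

2^_ : ℂ → ℂ
2^ z = exp (z *ᶜ log2)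

module _ where
  open ℂ[[t]]

  -- ((1 + t) ^ λ - 1) / 2, so that 1 + (1 + t) ^ λ = 2 (1 + innerSeries λ)
  innerSeries : ℂ → PowerSeries
  innerSeries lam zero    = 0#
  innerSeries lam (suc j) = fromℚ ½ * binom lam (suc j)

  -- (1 + (1 + t) ^ λ) ^ (- μ)
  petersFactor : ℂ → ℂ → PowerSeries
  petersFactor lam mu = (2^ (- mu)) · (([1+t]^ (- mu)) ⟨ innerSeries lam ⟩)

  -- (1 + (1 + t) ^ λ) ^ (- μ) Lif_k(log(1 + t))
  baseSeries : ℤ → ℂ → ℂ → PowerSeries
  baseSeries k lam mu = petersFactor lam mu ⊛ (Lif k ⟨ log[1+t] ⟩)

module _ where
  open ℂ[x][[t]]

  -- The exponent - X is the polynomial -x, so this is a series in t over ℂ[x].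
  generatingSeries : ℤ → ℂ → ℂ → PowerSeries
  generatingSeries k lam mu = (λ n → const (baseSeries k lam mu n)) ⊛ ([1+t]^ (- X))

  CP : ℤ → ℂ → ℂ → ℕ → Poly
  CP k lam mu n = (n !) × generatingSeries k lam mu n

{-# OPTIONS --safe #-}
module Submission where

-- The generating series in t is B(t) (1 + t)^(-x), where B does not involve x.
-- Since the falling factorial of -x of length m is (-1)^m times the rising
-- factorial of x, and n! / m! = (n C m) (n - m)!, its coefficients expand as
-- sums over the numbers j! [t^j] B. These are the values at x = 0, because
-- (1 + t)^0 = 1.

open import Defs using (module Polynomial; module Series)
open import Algebra.Bundles using (RawRing; AbelianGroup; CommutativeRing)
import Algebra.Consequences.Setoid as Consequences
import Algebra.Construct.Pointwise as Pointwise
import Algebra.Definitions.RawSemiring as RawSemiringDefs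
open import Algebra.Morphism.Structures using (IsGroupMonomorphism)
import Algebra.Morphism.GroupMonomorphism as GroupMonomorphism
import Algebra.Properties.CommutativeMonoid.Sum as CommutativeMonoidSum
import Algebra.Properties.CommutativeSemigroup as CommutativeSemigroupProperties
import Algebra.Properties.Ring as RingProperties
import Algebra.Properties.Semiring.Mult as SemiringMult
import Algebra.Properties.Semiring.Sum as SemiringSum
import Algebra.Solver.Ring.NaturalCoefficients.Default as SemiringSolver
open import Algebra.Structures using (IsAbelianGroup; IsCommutativeRing)
open import Data.Fin.Base as Fin using (Fin; toℕ)
open import Data.Fin.Permutation using (reverse)
open import Data.Fin.Properties using (opposite-prop; toℕ≤pred[n])
open import Data.Integer.Base using (ℤ; +_)
open import Data.List.Base using ([]; _∷_; map)
open import Data.Nat.Base as ℕ using (ℕ; zero; suc; _∸_; _!)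
open import Data.Nat.Combinatorics using (_C_; nCk≡n!/k![n-k]!; k![n∸k]!∣n!)
open import Data.Nat.DivMod using (m/n*n≡m)
import Data.Nat.Properties as ℕ
open import Data.Rational.Base as ℚ using (ℚ; 0ℚ; 1ℚ; _/_)
import Data.Rational.Properties as ℚ
import Relation.Binary.PropositionalEquality as ≡
open import Relation.Binary.PropositionalEquality using (_≡_)
import Relation.Binary.Reasoning.Setoid as SetoidReasoning

-- Polynomials over a commutative ring: ring laws and evaluation.

module PolynomialProperties {c ℓ} (R : CommutativeRing c ℓ) where
  open CommutativeRing R hiding (_-_)
  open Polynomial rawRing
  open _≈ₚ_
  open RingProperties ring using (-0#≈0#)
  open CommutativeSemigroupProperties +-commutativeSemigroup using (interchange)
  open CommutativeSemigroupProperties *-commutativeSemigroup using (x∙yz≈y∙xz)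
  open RawSemiringDefs (RawRing.rawSemiring rawRing) using (_×_; sum)
  private
    module P = RawRing polynomialRing
    module PD = RawSemiringDefs P.rawSemiring

  coeff-+ : ∀ p q n → coeff (p +ₚ q) n ≈ coeff p n + coeff q n
  coeff-+ []      q       n       = sym (+-identityˡ _)
  coeff-+ (a ∷ p) []      n       = sym (+-identityʳ _)
  coeff-+ (a ∷ p) (b ∷ q) zero    = refl
  coeff-+ (a ∷ p) (b ∷ q) (suc n) = coeff-+ p q n

  coeff-neg : ∀ p n → coeff (map -_ p) n ≈ - coeff p n
  coeff-neg []      n       = sym -0#≈0#
  coeff-neg (a ∷ p) zero    = refl
  coeff-neg (a ∷ p) (suc n) = coeff-neg p n

  -- Equality of polynomials is equality of coefficient sequences, so `coeff` is injective by
  -- definition. The additive group laws can then be pulled back from sequences, without inductions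
  -- on lists of unequal length.
  coeff-isGroupMonomorphism : IsGroupMonomorphism
    (record { _≈_ = _≈ₚ_ ; _∙_ = _+ₚ_ ; ε = [] ; _⁻¹ = map -_ })
    (AbelianGroup.rawGroup (Pointwise.abelianGroup ℕ +-abelianGroup))
    coeff
  coeff-isGroupMonomorphism = record
    { isGroupHomomorphism = record
      { isMonoidHomomorphism = record
        { isMagmaHomomorphism = record
          { isRelHomomorphism = record { cong = coeff-≈ }
          ; homo = coeff-+
          }
        ; ε-homo = λ _ → refl
        }
      ; ⁻¹-homo = coeff-neg
      }
    ; injective = mk≈ₚ
    }

  +ₚ-isAbelianGroup : IsAbelianGroup _≈ₚ_ _+ₚ_ [] (map -_)
  +ₚ-isAbelianGroup = GroupMonomorphism.isAbelianGroup coeff-isGroupMonomorphism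
    (Pointwise.isAbelianGroup ℕ +-isAbelianGroup)

  +ₚ-abelianGroup : AbelianGroup c ℓ
  +ₚ-abelianGroup = record { isAbelianGroup = +ₚ-isAbelianGroup }

  private
    module P+ = AbelianGroup +ₚ-abelianGroup

  open CommutativeSemigroupProperties P+.commutativeSemigroup
    using () renaming (interchange to +ₚ-interchange; x∙yz≈y∙xz to +ₚ-x∙yz≈y∙xz)

  scale : Carrier → Poly → Poly
  scale a = map (a *_)

  coeff-scale : ∀ a p n → coeff (scale a p) n ≈ a * coeff p n
  coeff-scale a []      n       = sym (zeroʳ a)
  coeff-scale a (b ∷ p) zero    = refl
  coeff-scale a (b ∷ p) (suc n) = coeff-scale a p n

  ∷-cong : ∀ {a b p q} → a ≈ b → p ≈ₚ q → a ∷ p ≈ₚ b ∷ q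
  ∷-cong a≈b p≈q .coeff-≈ zero    = a≈b
  ∷-cong a≈b p≈q .coeff-≈ (suc n) = coeff-≈ p≈q n

  0∷[]≈[] : 0# ∷ [] ≈ₚ []
  0∷[]≈[] .coeff-≈ zero    = refl
  0∷[]≈[] .coeff-≈ (suc n) = refl

  shift-+ : ∀ p q → 0# ∷ p +ₚ q ≈ₚ (0# ∷ p) +ₚ (0# ∷ q)
  shift-+ p q = ∷-cong (sym (+-identityˡ 0#)) P+.refl

  scale-cong : ∀ {a b p q} → a ≈ b → p ≈ₚ q → scale a p ≈ₚ scale b q
  scale-cong {a} {b} {p} {q} a≈b p≈q .coeff-≈ n = begin
    coeff (scale a p) n ≈⟨ coeff-scale a p n ⟩
    a * coeff p n       ≈⟨ *-cong a≈b (coeff-≈ p≈q n) ⟩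
    b * coeff q n       ≈⟨ coeff-scale b q n ⟨
    coeff (scale b q) n ∎
    where open SetoidReasoning setoid

  scale-1 : ∀ p → scale 1# p ≈ₚ p
  scale-1 p .coeff-≈ n = trans (coeff-scale 1# p n) (*-identityˡ _)

  scale-scale : ∀ a b p → scale (a * b) p ≈ₚ scale a (scale b p)
  scale-scale a b []      = P+.refl
  scale-scale a b (c ∷ p) = ∷-cong (*-assoc a b c) (scale-scale a b p)

  scale-distribʳ : ∀ a b p → scale (a + b) p ≈ₚ scale a p +ₚ scale b p
  scale-distribʳ a b []      = P+.refl
  scale-distribʳ a b (c ∷ p) = ∷-cong (distribʳ c a b) (scale-distribʳ a b p)

  scale-distribˡ : ∀ a p q → scale a (p +ₚ q) ≈ₚ scale a p +ₚ scale a q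
  scale-distribˡ a []      q       = P+.refl
  scale-distribˡ a (b ∷ p) []      = P+.refl
  scale-distribˡ a (b ∷ p) (c ∷ q) = ∷-cong (distribˡ a b c) (scale-distribˡ a p q)

  scale-* : ∀ a p q → scale a (p *ₚ q) ≈ₚ scale a p *ₚ q
  scale-* a []      q = P+.refl
  scale-* a (b ∷ p) q = P+.trans (scale-distribˡ a (scale b q) (0# ∷ p *ₚ q))
    (P+.∙-cong (P+.sym (scale-scale a b q)) (∷-cong (zeroʳ a) (scale-* a p q)))

  *ₚ-congˡ : ∀ p {q r} → q ≈ₚ r → p *ₚ q ≈ₚ p *ₚ r
  *ₚ-congˡ []      q≈r = P+.refl
  *ₚ-congˡ (a ∷ p) q≈r = P+.∙-cong (scale-cong refl q≈r) (∷-cong refl (*ₚ-congˡ p q≈r))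

  *ₚ-zeroʳ : ∀ p → p *ₚ [] ≈ₚ []
  *ₚ-zeroʳ []      = P+.refl
  *ₚ-zeroʳ (a ∷ p) = P+.trans (∷-cong refl (*ₚ-zeroʳ p)) 0∷[]≈[]

  -- The defining recursion of `*ₚ`, mirrored to the right factor. Commutativity is an induction
  -- that plays one recursion against the other.
  *ₚ-∷ : ∀ q a p → q *ₚ (a ∷ p) ≈ₚ scale a q +ₚ (0# ∷ q *ₚ p)
  *ₚ-∷ []      a p = P+.sym 0∷[]≈[]
  *ₚ-∷ (b ∷ q) a p = ∷-cong (+-congʳ (*-comm b a)) (P+.trans
    (P+.∙-congˡ (*ₚ-∷ q a p))
    (+ₚ-x∙yz≈y∙xz (scale b p) (scale a q) (0# ∷ q *ₚ p)))

  *ₚ-comm : ∀ p q → p *ₚ q ≈ₚ q *ₚ p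
  *ₚ-comm []      q = P+.sym (*ₚ-zeroʳ q)
  *ₚ-comm (a ∷ p) q = P+.trans (P+.∙-congˡ (∷-cong refl (*ₚ-comm p q))) (P+.sym (*ₚ-∷ q a p))

  -- The product recurses on its left factor, and equal polynomials may be lists of different
  -- lengths. Congruence on the left is therefore reduced by commutativity to congruence on the
  -- right.
  *ₚ-cong : ∀ {p q r s} → p ≈ₚ q → r ≈ₚ s → p *ₚ r ≈ₚ q *ₚ s
  *ₚ-cong {p} {q} {r} {s} p≈q r≈s = begin
    p *ₚ r ≈⟨ *ₚ-congˡ p r≈s ⟩
    p *ₚ s ≈⟨ *ₚ-comm p s ⟩
    s *ₚ p ≈⟨ *ₚ-congˡ s p≈q ⟩
    s *ₚ q ≈⟨ *ₚ-comm s q ⟩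
    q *ₚ s ∎
    where open SetoidReasoning P+.setoid

  *ₚ-distribʳ : ∀ r p q → (p +ₚ q) *ₚ r ≈ₚ p *ₚ r +ₚ q *ₚ r
  *ₚ-distribʳ r []      q       = P+.refl
  *ₚ-distribʳ r (a ∷ p) []      = P+.sym (P+.identityʳ _)
  *ₚ-distribʳ r (a ∷ p) (b ∷ q) = P+.trans
    (P+.∙-cong (scale-distribʳ a b r)
      (P+.trans (∷-cong refl (*ₚ-distribʳ r p q)) (shift-+ (p *ₚ r) (q *ₚ r))))
    (+ₚ-interchange (scale a r) (scale b r) (0# ∷ p *ₚ r) (0# ∷ q *ₚ r))

  -- The recursion leaves the summand `scale 0# q`, a list of zeros that in general equals `[]` only
  -- coefficientwise.
  shift-* : ∀ p q → (0# ∷ p) *ₚ q ≈ₚ 0# ∷ p *ₚ q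
  shift-* p q = P+.trans (P+.∙-congʳ scale-0) (P+.identityˡ _)
    where
    scale-0 : scale 0# q ≈ₚ []
    scale-0 .coeff-≈ n = trans (coeff-scale 0# q n) (zeroˡ _)

  *ₚ-assoc : ∀ p q r → (p *ₚ q) *ₚ r ≈ₚ p *ₚ (q *ₚ r)
  *ₚ-assoc []      q r = P+.refl
  *ₚ-assoc (a ∷ p) q r = P+.trans (*ₚ-distribʳ r (scale a q) (0# ∷ p *ₚ q))
    (P+.∙-cong (P+.sym (scale-* a q r))
      (P+.trans (shift-* (p *ₚ q) r) (∷-cong refl (*ₚ-assoc p q r))))

  *ₚ-identityˡ : ∀ p → const 1# *ₚ p ≈ₚ p
  *ₚ-identityˡ p = P+.trans (P+.∙-cong (scale-1 p) 0∷[]≈[]) (P+.identityʳ p)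

  polynomial-isCommutativeRing : IsCommutativeRing _≈ₚ_ _+ₚ_ _*ₚ_ (map -_) [] (const 1#)
  polynomial-isCommutativeRing = record
    { isRing = record
      { +-isAbelianGroup = +ₚ-isAbelianGroup
      ; *-cong           = *ₚ-cong
      ; *-assoc          = *ₚ-assoc
      ; *-identity       = comm∧idˡ⇒id *ₚ-comm *ₚ-identityˡ
      ; distrib          = comm∧distrʳ⇒distr P+.∙-cong *ₚ-comm *ₚ-distribʳ
      }
    ; *-comm = *ₚ-comm
    }
    where open Consequences P+.setoid

  polynomial-commutativeRing : CommutativeRing c ℓ
  polynomial-commutativeRing = record { isCommutativeRing = polynomial-isCommutativeRing }

  const-cong : ∀ {a b} → a ≈ b → const a ≈ₚ const b
  const-cong a≈b = ∷-cong a≈b P+.refl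

  const-× : ∀ n a → const (n × a) ≈ₚ n PD.× const a
  -- The constant polynomial of `0#` is the list `0# ∷ []`, whereas the zero polynomial is `[]`.
  const-× zero    a = 0∷[]≈[]
  const-× (suc n) a = P+.∙-congˡ (const-× n a)

  module _ (x : Carrier) where

    eval-const : ∀ a → eval (const a) x ≈ a
    eval-const a = trans (+-congˡ (zeroʳ x)) (+-identityʳ a)

    eval-+ : ∀ p q → eval (p +ₚ q) x ≈ eval p x + eval q x
    eval-+ []      q       = sym (+-identityˡ _)
    eval-+ (a ∷ p) []      = sym (+-identityʳ _)
    eval-+ (a ∷ p) (b ∷ q) = trans
      (+-congˡ (trans (*-congˡ (eval-+ p q)) (distribˡ x _ _)))
      (interchange a b _ _)

    eval-scale : ∀ a p → eval (scale a p) x ≈ a * eval p x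
    eval-scale a []      = sym (zeroʳ a)
    eval-scale a (b ∷ p) = trans
      (+-congˡ (trans (*-congˡ (eval-scale a p)) (x∙yz≈y∙xz x a _)))
      (sym (distribˡ a b _))

    eval-* : ∀ p q → eval (p *ₚ q) x ≈ eval p x * eval q x
    eval-* []      q = sym (zeroˡ _)
    eval-* (a ∷ p) q = begin
      eval (scale a q +ₚ (0# ∷ p *ₚ q)) x             ≈⟨ eval-+ (scale a q) _ ⟩
      eval (scale a q) x + (0# + x * eval (p *ₚ q) x) ≈⟨ +-cong (eval-scale a q) (+-identityˡ _) ⟩
      a * eval q x + x * eval (p *ₚ q) x              ≈⟨ +-congˡ (*-congˡ (eval-* p q)) ⟩
      a * eval q x + x * (eval p x * eval q x)        ≈⟨ +-congˡ (*-assoc x _ _) ⟨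
      a * eval q x + x * eval p x * eval q x          ≈⟨ distribʳ _ a _ ⟨
      (a + x * eval p x) * eval q x                   ∎
      where open SetoidReasoning setoid

    eval-× : ∀ n p → eval (n PD.× p) x ≈ n × eval p x
    eval-× zero    p = refl
    eval-× (suc n) p = trans (eval-+ p _) (+-congˡ (eval-× n p))

    eval-sum : ∀ {n} (f : Fin n → Poly) → eval (PD.sum f) x ≈ sum (λ i → eval (f i) x)
    eval-sum {zero}  f = refl
    eval-sum {suc n} f = trans (eval-+ (f Fin.zero) _) (+-congˡ (eval-sum (λ i → f (Fin.suc i))))

-- Factorials, convolution and the series (1 + t)^(-a).

n!≡nCm*m!*[n∸m]! : ∀ {m n} → m ℕ.≤ n → n ! ≡ (n C m) ℕ.* (m ! ℕ.* (n ∸ m) !)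
n!≡nCm*m!*[n∸m]! {m} {n} m≤n = ≡.sym (≡.trans
  (≡.cong (ℕ._* (m ! ℕ.* (n ∸ m) !)) (nCk≡n!/k![n-k]! m≤n))
  -- The quotient formula for `n C m` can be multiplied out because m! (n - m)! divides n! exactly.
  (m/n*n≡m {{m ℕ.!* (n ∸ m) !≢0}} (k![n∸k]!∣n! m≤n)))

module SeriesProperties {c ℓ} (R : CommutativeRing c ℓ) (fromRational : ℚ → CommutativeRing.Carrier R) where
  open CommutativeRing R hiding (_-_)
  open Series rawRing fromRational
    using (_×_; _^_; product; Σ≤; falling; rising; invFactorial; PowerSeries; _⊛_; one; [1+t]^_)
  open RingProperties ring using (-1*x≈-x; -‿+-comm)
  open SemiringSum semiring using (sum-cong-≋; sum-replicate-zero; ∑-permute; *-distribˡ-sum)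
  open SemiringMult semiring using (×-congˡ; ×-assoc-*; ×-congʳ; ×1-homo-*)
  open SemiringSolver commutativeSemiring using (solve; _:=_; _:*_)
  open SetoidReasoning setoid

  private
    module ∏ = CommutativeMonoidSum *-commutativeMonoid

  Σ≤-cong : ∀ n {f g} → (∀ m → m ℕ.≤ n → f m ≈ g m) → Σ≤ n f ≈ Σ≤ n g
  Σ≤-cong n f≈g = sum-cong-≋ {suc n} λ i → f≈g (toℕ i) (toℕ≤pred[n] i)

  Σ≤-reverse : ∀ n f → Σ≤ n f ≈ Σ≤ n (λ m → f (n ∸ m))
  Σ≤-reverse n f = trans
    (∑-permute {suc n} (λ i → f (toℕ i)) reverse)
    (sum-cong-≋ {suc n} λ i → reflexive (≡.cong f (opposite-prop i)))

  -- Makes the index of the second factor the summation index, as in the expansion sought, where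
  -- x^(m) comes from the second factor.
  ⊛-reverse : ∀ f g n → (f ⊛ g) n ≈ Σ≤ n (λ m → f (n ∸ m) * g m)
  ⊛-reverse f g n = trans (Σ≤-reverse n (λ m → f m * g (n ∸ m))) (Σ≤-cong n λ m m≤n →
    *-congˡ {f (n ∸ m)} (reflexive (≡.cong g (ℕ.m∸[m∸n]≡n m≤n))))

  ⊛-identityʳ : ∀ f n → (f ⊛ one) n ≈ f n
  ⊛-identityʳ f n = begin
    (f ⊛ one) n                    ≈⟨ ⊛-reverse f one n ⟩
    Σ≤ n (λ m → f (n ∸ m) * one m) ≈⟨ +-cong (*-identityʳ (f n)) (trans
                                        (sum-cong-≋ {n} λ _ → zeroʳ _) (sum-replicate-zero n)) ⟩
    f n + 0#                       ≈⟨ +-identityʳ (f n) ⟩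
    f n                            ∎

  -- Turns repeated addition into multiplication by a ring element, so that distributivity and the
  -- solver can handle factorials and binomial coefficients as factors.
  ×≈×1* : ∀ n a → n × a ≈ (n × 1#) * a
  ×≈×1* n a = sym (trans (×-assoc-* n 1# a) (×-congʳ n (*-identityˡ a)))

  -- Each factor -a - i equals -(a + i), and the m signs are collected in front.
  falling-neg : ∀ a m → falling (- a) m ≈ (- 1#) ^ m * rising a m
  falling-neg a m = begin
    -- `∏` holds the lemmas on finite sums read in the multiplicative monoid: there `∑-distrib-+`
    -- splits a product of products, and `sum-replicate` gives a power.
    falling (- a) m                             ≈⟨ ∏.sum-cong-≋ {m} (λ i → trans (-‿+-comm a _) (sym (-1*x≈-x _))) ⟩
    product {m} (λ i → - 1# * (a + toℕ i × 1#)) ≈⟨ ∏.∑-distrib-+ {m} (λ _ → - 1#) _ ⟩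
    product {m} (λ _ → - 1#) * rising a m       ≈⟨ *-congʳ (∏.sum-replicate m) ⟩
    (- 1#) ^ m * rising a m                     ∎

  module _ (!-inverse : ∀ n → (n !) × invFactorial n ≈ 1#) where

    -- Write n! as (n C m) m! (n - m)!. Then (n - m)! turns the coefficient of `f` into `g (n ∸ m)`,
    -- m! cancels the denominator of the binomial coefficient of -a, and `falling-neg` supplies sign
    -- and rising factorial. Keeping `g` abstract lets it later be a sequence of values at 0.
    !×⊛[1+t]^- : ∀ (f g : PowerSeries) → (∀ j → g j ≈ (j !) × f j) → ∀ a n →
      (n !) × (f ⊛ ([1+t]^ (- a))) n ≈
      Σ≤ n (λ m → (- 1#) ^ m * ((n C m) × 1#) * g (n ∸ m) * rising a m)
    !×⊛[1+t]^- f g g≈!f a n = begin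
      (n !) × (f ⊛ ([1+t]^ (- a))) n
        ≈⟨ ×≈×1* (n !) _ ⟩
      ((n !) × 1#) * (f ⊛ ([1+t]^ (- a))) n
        ≈⟨ *-congˡ (⊛-reverse f ([1+t]^ (- a)) n) ⟩
      ((n !) × 1#) * Σ≤ n (λ m → f (n ∸ m) * ([1+t]^ (- a)) m)
        ≈⟨ *-distribˡ-sum {suc n} ((n !) × 1#) (λ i → f (n ∸ toℕ i) * ([1+t]^ (- a)) (toℕ i)) ⟩
      Σ≤ n (λ m → ((n !) × 1#) * (f (n ∸ m) * ([1+t]^ (- a)) m))
        ≈⟨ Σ≤-cong n term ⟩
      Σ≤ n (λ m → (- 1#) ^ m * ((n C m) × 1#) * g (n ∸ m) * rising a m) ∎
      where
      !-split : ∀ m → m ℕ.≤ n →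
        (n !) × 1# ≈ ((n C m) × 1#) * (((m !) × 1#) * (((n ∸ m) !) × 1#))
      !-split m m≤n = begin
        (n !) × 1#                                           ≈⟨ ×-congˡ (n!≡nCm*m!*[n∸m]! m≤n) ⟩
        ((n C m) ℕ.* (m ! ℕ.* (n ∸ m) !)) × 1#               ≈⟨ ×1-homo-* (n C m) _ ⟩
        ((n C m) × 1#) * ((m ! ℕ.* (n ∸ m) !) × 1#)          ≈⟨ *-congˡ (×1-homo-* (m !) _) ⟩
        ((n C m) × 1#) * (((m !) × 1#) * (((n ∸ m) !) × 1#)) ∎

      -- Here s is the sign, c is n C m, k is (n - m)!, b is the coefficient of `f`, r is the rising
      -- factorial, and u and i are m! and its inverse.
      regroup : ∀ s c k b r u i →
        (c * (u * k)) * (b * ((s * r) * i)) ≈ (s * c * (k * b) * r) * (u * i)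
      regroup = solve 7 (λ s c k b r u i →
        (c :* (u :* k)) :* (b :* ((s :* r) :* i)) := (s :* c :* (k :* b) :* r) :* (u :* i)) refl

      term : ∀ m → m ℕ.≤ n → ((n !) × 1#) * (f (n ∸ m) * ([1+t]^ (- a)) m) ≈
        (- 1#) ^ m * ((n C m) × 1#) * g (n ∸ m) * rising a m
      term m m≤n = begin
        ((n !) × 1#) * (f (n ∸ m) * (falling (- a) m * invFactorial m))
          ≈⟨ *-cong (!-split m m≤n) (*-congˡ (*-congʳ (falling-neg a m))) ⟩
        ((n C m) × 1#) * (((m !) × 1#) * (((n ∸ m) !) × 1#)) *
          (f (n ∸ m) * ((- 1#) ^ m * rising a m * invFactorial m))
          ≈⟨ regroup _ _ _ _ _ _ _ ⟩
        (- 1#) ^ m * ((n C m) × 1#) * ((((n ∸ m) !) × 1#) * f (n ∸ m)) * rising a m *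
          (((m !) × 1#) * invFactorial m)
          ≈⟨ *-cong (*-congʳ (*-congˡ (sym (trans (g≈!f (n ∸ m)) (×≈×1* ((n ∸ m) !) _)))))
                    (trans (sym (×≈×1* (m !) _)) (!-inverse m)) ⟩
        (- 1#) ^ m * ((n C m) × 1#) * g (n ∸ m) * rising a m * 1#
          ≈⟨ *-identityʳ _ ⟩
        (- 1#) ^ m * ((n C m) × 1#) * g (n ∸ m) * rising a m ∎

-- Series in t over R[x] and their values at x = 0.

module PolynomialSeries {c ℓ} (R : CommutativeRing c ℓ) (fromRational : ℚ → CommutativeRing.Carrier R) where
  open Polynomial (CommutativeRing.rawRing R)
  open PolynomialProperties R
  private
    module R = CommutativeRing R
    module R[[t]] = Series R.rawRing fromRational
    module R[x] = CommutativeRing polynomial-commutativeRing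
    module SR = SeriesProperties R fromRational
    module SR[x] = SeriesProperties polynomial-commutativeRing (λ q → const (fromRational q))
  open SemiringMult R.semiring using (×-congʳ)
  open Series polynomialRing (λ q → const (fromRational q))

  -- Each coefficient of a convolution is a finite sum of products, and evaluation respects both
  -- operations.
  eval-⊛ : ∀ x (f g : PowerSeries) n →
    eval ((f ⊛ g) n) x R.≈ ((λ i → eval (f i) x) R[[t]].⊛ (λ i → eval (g i) x)) n
  eval-⊛ x f g n = R.trans (eval-sum x {suc n} (λ i → f (toℕ i) *ₚ g (n ∸ toℕ i)))
    (SR.Σ≤-cong n λ i _ → eval-* x (f i) (g (n ∸ i)))

  module _ (!-inverse : ∀ n → (n !) R[[t]].× R[[t]].invFactorial n R.≈ R.1#) where

    -- This is (1 + t)^0 = 1. In degree 0 the falling factorial is the empty product; in higher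
    -- degree its first factor vanishes at x = 0.
    eval-[1+t]^-X : ∀ n → eval (([1+t]^ (- X)) n) R.0# R.≈ R[[t]].one n
    eval-[1+t]^-X zero = begin
      eval (const R.1# *ₚ const (R[[t]].invFactorial 0)) R.0#
        ≈⟨ eval-* R.0# (const R.1#) (const (R[[t]].invFactorial 0)) ⟩
      eval (const R.1#) R.0# R.* eval (const (R[[t]].invFactorial 0)) R.0#
        ≈⟨ R.*-cong (eval-const R.0# R.1#) (eval-const R.0# (R[[t]].invFactorial 0)) ⟩
      R.1# R.* R[[t]].invFactorial 0   ≈⟨ R.*-identityˡ _ ⟩
      R[[t]].invFactorial 0            ≈⟨ R.+-identityʳ _ ⟨
      1 R[[t]].× R[[t]].invFactorial 0 ≈⟨ !-inverse 0 ⟩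
      R.1#                             ∎
      where open SetoidReasoning R.setoid
    eval-[1+t]^-X (suc n) = begin
      eval (falling (- X) (suc n) *ₚ const (R[[t]].invFactorial (suc n))) R.0#
        ≈⟨ eval-* R.0# (falling (- X) (suc n)) (const (R[[t]].invFactorial (suc n))) ⟩
      eval (falling (- X) (suc n)) R.0# R.* _
        -- The first factor, - X minus `0 × 1#`, computes to `- X`, because `0 × 1#` is `[]`.
        ≈⟨ R.*-congʳ (eval-* R.0# (- X) (product {n} (λ i → - X + - (toℕ (Fin.suc i) × 1#)))) ⟩
      eval (- X) R.0# R.* _ R.* _ ≈⟨ R.*-congʳ (R.*-congʳ eval-neg-X) ⟩
      R.0# R.* _ R.* _            ≈⟨ R.*-congʳ (R.zeroˡ _) ⟩
      R.0# R.* _                  ≈⟨ R.zeroˡ _ ⟩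
      R.0#                        ∎
      where
      open SetoidReasoning R.setoid
      open RingProperties R.ring using (-0#≈0#)
      eval-neg-X : eval (- X) R.0# R.≈ R.0#
      eval-neg-X = R.trans (R.+-cong -0#≈0# (R.zeroˡ _)) (R.+-identityʳ R.0#)

    !-inverse-const : ∀ n → (n !) × invFactorial n ≈ 1#
    !-inverse-const n = R[x].trans (R[x].sym (const-× (n !) _)) (const-cong (!-inverse n))

    module _ (f : R[[t]].PowerSeries) where

      -- The analogue of an Appell sequence with (1 + t)^(-x) in the place of e^(xt).
      appell : ℕ → Poly
      appell n = (n !) × ((λ i → const (f i)) ⊛ ([1+t]^ (- X))) n

      eval-appell-0 : ∀ n → eval (appell n) R.0# R.≈ (n !) R[[t]].× f n
      eval-appell-0 n = R.trans (eval-× R.0# (n !) _) (×-congʳ (n !) (begin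
        eval (((λ i → const (f i)) ⊛ ([1+t]^ (- X))) n) R.0#
          ≈⟨ eval-⊛ R.0# (λ i → const (f i)) ([1+t]^ (- X)) n ⟩
        ((λ i → eval (const (f i)) R.0#) R[[t]].⊛ (λ i → eval (([1+t]^ (- X)) i) R.0#)) n
          ≈⟨ SR.Σ≤-cong n (λ i _ → R.*-cong (eval-const R.0# (f i)) (eval-[1+t]^-X (n ∸ i))) ⟩
        (f R[[t]].⊛ R[[t]].one) n
          ≈⟨ SR.⊛-identityʳ f n ⟩
        f n ∎))
        where open SetoidReasoning R.setoid

      appell-expansion : ∀ n → appell n ≈
        Σ≤ n (λ m → (- 1#) ^ m * ((n C m) × 1#) * const (eval (appell (n ∸ m)) R.0#) * rising X m)
      -- The general expansion is used over R[x] at a = X, with `g j` the constant polynomial of the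
      -- value of `appell j` at 0; `eval-appell-0` shows that this is j! times the j-th coefficient.
      appell-expansion = SR[x].!×⊛[1+t]^- !-inverse-const _ _
        (λ j → R[x].trans (const-cong (eval-appell-0 j)) (const-× (j !) (f j))) X

-- Complex coefficients: inverse factorials and the theorem.

open import Defs

-- Moves the cancellation of factorials from Cauchy sequences to rational arithmetic: constant
-- sequences are compared entry by entry.
×-fromℚ : ∀ n q → n ℂ[[t]].× fromℚ q ≈ᶜ fromℚ (fromℕ n ℚ.* q)
×-fromℚ zero    q = pointwise λ _ → ≡.cong embed (≡.sym (ℚ.*-zeroˡ q))
×-fromℚ (suc n) q = begin
  fromℚ q +ᶜ n ℂ[[t]].× fromℚ q    ≈⟨ +-congˡ (×-fromℚ n q) ⟩
  fromℚ q +ᶜ fromℚ (fromℕ n ℚ.* q) ≈⟨ pointwise (λ _ → ≡.cong₂ _+i_ (≡.sym suc-*) (ℚ.+-identityˡ 0ℚ)) ⟩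
  fromℚ (fromℕ (suc n) ℚ.* q)      ∎
  where
  open CommutativeRing ℂ-commutativeRing using (setoid; +-congˡ)
  open SetoidReasoning setoid
  suc-* : fromℕ (suc n) ℚ.* q ≡ q ℚ.+ fromℕ n ℚ.* q
  suc-* = ≡.trans (≡.cong (ℚ._* q) (fromℕ-suc n)) (≡.trans
    (ℚ.*-distribʳ-+ q 1ℚ (fromℕ n)) (≡.cong (ℚ._+ fromℕ n ℚ.* q) (ℚ.*-identityˡ q)))

-- Stated for any nonzero n because n! is not syntactically a successor; matching on n exposes
-- `recip`.
fromℕ-*-/ : ∀ n .{{_ : ℕ.NonZero n}} → fromℕ n ℚ.* (+ 1 / n) ≡ 1ℚ
fromℕ-*-/ (suc n) = ≡.trans (ℚ.*-comm (fromℕ (suc n)) (recip n)) (recip-inverse n)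

!×invFactorial : ∀ n → (n !) ℂ[[t]].× ℂ[[t]].invFactorial n ≈ᶜ fromℚ 1ℚ
!×invFactorial n = ≈ᶜ-trans (×-fromℚ (n !) _)
  (pointwise λ _ → ≡.cong embed (fromℕ-*-/ (n !) {{n ℕ.!≢0}}))

theorem12 : let open ℂ[x][[t]] in
    (k : ℤ) (lam mu : ℂ) (n : ℕ) →
    CP k lam mu n ≈
    Σ≤ n (λ m → (- 1#) ^ m * ((n C m) × 1#) * const (eval (CP k lam mu (n ∸ m)) (fromℚ 0ℚ)) * rising X m)
-- `CP k lam mu` unfolds to `appell` with the coefficients of `baseSeries k lam mu`, which are free
-- of x.
theorem12 k lam mu = PolynomialSeries.appell-expansion ℂ-commutativeRing fromℚ !×invFactorial (baseSeries k lam mu)
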